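{- For every integer $n\ge 6$, $$\mathrm{sat}(n,2\mathcal{C}_{\ge3})=\begin{cases}10 & n=6,\\ n+5 & n\ge 7.\end{cases}$$
   Context: All graphs are finite and simple. For a family $\mathcal{H}$ of graphs, a graph $G$ is $\mathcal{H}$-saturated if $G$ contains no subgraph isomorphic to a member of $\mathcal{H}$, but for every pair of non-adjacent vertices $u,v$ the graph $G+uv$ contains a subgraph isomorphic to some member of $\mathcal{H}$. $\mathrm{sat}(n,\mathcal{H})$ is the minimum number of edges of an $n$-vertex $\mathcal{H}$-saturated graph. $\mathcal{C}_{\ge3}=\{C_3,C_4,\dots\}$ is the family of all cycles, and $k\mathcal{C}_{\ge3}$ is the family of all vertex-disjoint unions of $k$ (not necessarily distinct) cycles; thus a graph is $k\mathcal{C}_{\ge3}$-saturated iff it has no $k$ pairwise vertex-disjoint cycles but adding any non-edge creates $k$ pairwise vertex-disjoint cycles. -}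

module Defs where

open import Data.Nat using (ℕ; zero; suc; _+_; _≤_; _<_)
open import Data.Fin using (Fin; _<?_) renaming (_<_ to _<ᶠ_)
open import Data.Bool using (Bool; true; false; _∨_; _∧_)
open import Data.List using (List; []; _∷_; length; filterᵇ; cartesianProduct; allFin; _++_)
open import Data.List.Membership.Propositional using (_∈_; _∉_)
open import Data.List.Relation.Unary.Unique.Propositional using (Unique)
open import Data.List.Relation.Unary.All using (All)
open import Data.Product using (Σ; _×_; _,_; ∃-syntax; proj₁; proj₂)
open import Relation.Binary.PropositionalEquality using (_≡_; _≢_)
open import Relation.Nullary using (¬_)
open import Relation.Nullary.Decidable using (⌊_⌋)
open import Data.Fin using (_≟_)

record Graph (n : ℕ) : Set where
  field
    adj   : Fin n → Fin n → Bool
    sym   : ∀ u v → adj u v ≡ adj v u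
    irrefl : ∀ v → adj v v ≡ false
open Graph public

Adj : ∀ {n} → Graph n → Fin n → Fin n → Set
Adj G u v = adj G u v ≡ true

edgeCount : ∀ {n} → Graph n → ℕ
edgeCount {n} G =
  length (filterᵇ (λ p → ⌊ proj₁ p <? proj₂ p ⌋ ∧ adj G (proj₁ p) (proj₂ p))
                 (cartesianProduct (allFin n) (allFin n)))

addEdge : ∀ {n} (G : Graph n) (u v : Fin n) → u ≢ v → Graph n
addEdge {n} G u v u≢v = record { adj = a ; sym = s ; irrefl = i }
  where
  isUV : Fin n → Fin n → Bool
  isUV x y = (⌊ x ≟ u ⌋ ∧ ⌊ y ≟ v ⌋) ∨ (⌊ x ≟ v ⌋ ∧ ⌊ y ≟ u ⌋)
  a : Fin n → Fin n → Bool
  a x y = adj G x y ∨ isUV x y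
  symProof : ∀ x y → a x y ≡ a y x
  symProof x y = helper
    where
    open import Relation.Binary.PropositionalEquality using (refl)
    open import Data.Bool.Properties using (∨-comm; ∧-comm)
    helper : a x y ≡ a y x
    helper rewrite Graph.sym G x y
                 | ∧-comm ⌊ x ≟ u ⌋ ⌊ y ≟ v ⌋
                 | ∧-comm ⌊ x ≟ v ⌋ ⌊ y ≟ u ⌋
                 | ∨-comm (⌊ y ≟ v ⌋ ∧ ⌊ x ≟ u ⌋) (⌊ y ≟ u ⌋ ∧ ⌊ x ≟ v ⌋)
                 = refl
  s = symProof
  i : ∀ x → a x x ≡ false
  i x = irr
    where
    open import Relation.Binary.PropositionalEquality using (refl)
    open import Data.Bool.Properties using (∨-identityʳ)
    open import Data.Empty using (⊥-elim)
    import Relation.Binary.PropositionalEquality as Eq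
    irr : a x x ≡ false
    irr with x ≟ u | x ≟ v
    ... | Relation.Nullary.yes refl | Relation.Nullary.yes refl = ⊥-elim (u≢v refl)
    ... | Relation.Nullary.yes refl | Relation.Nullary.no _ rewrite irrefl G x = refl
    ... | Relation.Nullary.no _ | Relation.Nullary.yes refl rewrite irrefl G x = refl
    ... | Relation.Nullary.no _ | Relation.Nullary.no _ rewrite irrefl G x = refl

data PathAdj {n} (G : Graph n) : List (Fin n) → Set where
  []  : PathAdj G []
  [_] : ∀ x → PathAdj G (x ∷ [])
  _∷_ : ∀ {x y xs} → Adj G x y → PathAdj G (y ∷ xs) → PathAdj G (x ∷ y ∷ xs)

-- A cycle in G: a list x₀ … x_{k-1} of k ≥ 3 pairwise distinct vertices with
-- xᵢ ~ xᵢ₊₁ and x_{k-1} ~ x₀.  Equivalently, a subgraph isomorphic to some C_k, k ≥ 3.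
record Cycle {n} (G : Graph n) : Set where
  field
    first  : Fin n
    middle : List (Fin n)
    last   : Fin n
    long   : 1 ≤ length middle
    distinct : Unique (first ∷ (middle ++ (last ∷ [])))
    path   : PathAdj G (first ∷ (middle ++ (last ∷ [])))
    closes : Adj G last first
  verts : List (Fin n)
  verts = first ∷ (middle ++ (last ∷ []))
open Cycle public

TwoDisjointCycles : ∀ {n} → Graph n → Set
TwoDisjointCycles G =
  Σ (Cycle G) λ C → Σ (Cycle G) λ D → All (λ x → x ∉ verts D) (verts C)

Saturated : ∀ {n} → Graph n → Set
Saturated {n} G =
  ¬ TwoDisjointCycles G ×
  (∀ (u v : Fin n) (u≢v : u ≢ v) → adj G u v ≡ false →
     TwoDisjointCycles (addEdge G u v u≢v))

SatNumberIs : ℕ → ℕ → Set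
SatNumberIs n m =
  (Σ (Graph n) λ G → Saturated G × edgeCount G ≡ m) ×
  (∀ (G : Graph n) → Saturated G → m ≤ edgeCount G)

-- Call a vertex set a core if it induces minimum degree at least 2; a graph has two disjoint
-- cycles iff it has two disjoint cores.  Saturation survives deleting a leaf and suppressing a
-- vertex of degree 2 with non-adjacent neighbours, and both operations preserve e - n.  So let
-- n ≥ 7 and e ≤ n + 4, let all degrees be at least 2 and let every vertex of degree 2 lie in a
-- triangle with its neighbours; then the excess Σ (deg v - 2) is at most 8.  If some vertex meets
-- all cycles, then G is this vertex joined to a tree, which has too many edges for n ≥ 8, while
-- a search excludes n = 7.  Otherwise the complement of a triangle is a forest, and counting edges
-- shows that it contains a vertex of degree 2.  Hence there are two such vertices w, w′ with
-- intersecting triangles, and the cores that saturation provides for suitable non-edges push the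
-- excess beyond 8.  A triangle-free G has n ≤ 8 and contains a 4-cycle, and then has too many
-- edges: by the forest count if n = 8, by extending the 4-cycle to K₃,₄ if n = 7.  The induction
-- rests on six vertices, where an exhaustive search shows that the only saturated graph with at
-- most 10 edges is the wheel.
module Submission where

open import Defs hiding (sym)
open import Data.Nat hiding (_≟_)
import Data.Nat as Nat
open import Data.Nat.Properties hiding (_≟_)
open import Data.Nat.Tactic.RingSolver using (solve-∀)
open import Data.Fin using (Fin; zero; suc; toℕ; punchIn; punchOut; _≟_) renaming (_<?_ to _<ᶠ?_)
open import Data.Fin.Properties using (any?; all?; toℕ-injective; punchIn-injective; punchIn-punchOut; punchInᵢ≢i)
open import Data.Bool using (Bool; true; false; _∧_; _∨_; not)
import Data.Bool as Bool
open import Data.Bool.Properties using (∨-zeroʳ; ∧-zeroʳ; ∧-comm; ∨-comm)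
import Data.List as List
open import Data.List using (List; []; _∷_; length; map; _++_; filterᵇ; tabulate; cartesianProduct)
open import Data.List.Relation.Unary.All as All using (All; []; _∷_)
import Data.List.Relation.Unary.All.Properties as All
open import Data.List.Properties using (++-assoc)
open import Data.List.Membership.Propositional.Properties using (∈-∃++; ∈-++⁺ʳ; ∈-lookup)
open import Data.List.Relation.Unary.Any as Any using (here; there)
open import Data.List.Relation.Unary.Any.Properties using (lookup-index)
open import Data.List.Relation.Unary.AllPairs using ([]; _∷_)
open import Data.List.Relation.Unary.Unique.Propositional using (Unique)
open import Data.List.Relation.Unary.Unique.DecPropositional using () renaming (unique? to unique?-dec)
open import Data.List.Membership.Propositional using (_∈_; _∉_)
open import Data.List.Membership.DecPropositional using () renaming (_∈?_ to ∈?-dec)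
open import Data.Product using (Σ; Σ-syntax; ∃; ∃-syntax; ∃₂; _×_; _,_; proj₁; proj₂; map₂)
open import Data.Sum using (_⊎_; inj₁; inj₂; [_,_]′) renaming (map to map-⊎)
open import Data.Unit using (⊤; tt)
open import Data.Vec as Vec using (Vec; []; _∷_; lookup)
open import Data.Vec.Properties using (lookup∘tabulate)
open import Data.Empty using (⊥; ⊥-elim)
open import Function using (_∘_; id; case_of_; flip)
open import Relation.Nullary
open import Relation.Nullary.Decidable using (⌊_⌋; _×-dec_; _→-dec_; _⊎-dec_; ¬?; decidable-stable; map′; from-yes)
open import Relation.Binary.PropositionalEquality hiding ([_])
open import Algebra.Properties.CommutativeMonoid.Sum +-0-commutativeMonoid
  using (sum; sum-cong-≗; ∑-distrib-+; ∑-comm; sum-remove)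
open import Algebra.Properties.CommutativeSemigroup *-commutativeSemigroup using (x∙yz≈y∙xz)

-- Sums and counts over finite sets

-- The obstacle is the wheel on six vertices. It is saturated with `n + 4` edges, one fewer than the
-- `n + 5` of a `K₅` with pendant vertices, which is extremal from seven vertices on. The induction
-- therefore has no base case at six: a reduction that leads from seven vertices to six ends in the
-- wheel, and one has to show that no saturated graph on seven vertices reduces to it. Edges are
-- counted through degree sums, so that `n + 4` edges read `degSum G ≤ 2 * n + 8`. Cores replace
-- cycles because a minimum degree condition passes through deletion and subdivision vertex by
-- vertex, with no cyclic order to maintain. `Linked` expresses the effect of an added edge `uv`
-- inside `G` itself, so the structural part never leaves `G`. Its goals are all `⊥`, so the
-- existence of a core missing a given vertex may be carried under a double negation.

infix 4 _∈?_
_∈?_ : ∀ {n} (x : Fin n) (L : List (Fin n)) → Dec (x ∈ L)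
_∈?_ = ∈?-dec _≟_

ind : Bool → ℕ
ind true  = 1
ind false = 0

ind-∧ : ∀ a b → ind (a ∧ b) ≡ ind a * ind b
ind-∧ true  b = sym (+-identityʳ _)
ind-∧ false b = refl

ind-not : ∀ b → ind b + ind (not b) ≡ 1
ind-not true  = refl
ind-not false = refl

≢true⇒≡false : ∀ {b} → ¬ (b ≡ true) → b ≡ false
≢true⇒≡false {true}  h = contradiction refl h
≢true⇒≡false {false} h = refl

count : ∀ {n} → (Fin n → Bool) → ℕ
count S = sum (ind ∘ S)

δ : ∀ {n} → Fin n → Fin n → ℕ
δ x i = ind ⌊ i ≟ x ⌋

δ-refl : ∀ {n} (x : Fin n) → δ x x ≡ 1
δ-refl x with x ≟ x
... | yes _ = refl
... | no h  = contradiction refl h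

δ-≢ : ∀ {n} {x i : Fin n} → i ≢ x → δ x i ≡ 0
δ-≢ {x = x} {i} h with i ≟ x
... | yes p = contradiction p h
... | no _  = refl

sum-mono : ∀ {n} {f g : Fin n → ℕ} → (∀ i → f i ≤ g i) → sum f ≤ sum g
sum-mono {zero}  h = z≤n
sum-mono {suc n} h = +-mono-≤ (h zero) (sum-mono (h ∘ suc))

sum-*ˡ : ∀ {n} c (f : Fin n → ℕ) → sum (λ i → c * f i) ≡ c * sum f
sum-*ˡ {zero}  c f = sym (*-zeroʳ c)
sum-*ˡ {suc n} c f = trans (cong (c * f zero +_) (sum-*ˡ c (f ∘ suc))) (sym (*-distribˡ-+ c _ _))

sum-const : ∀ n c → sum {n} (λ _ → c) ≡ n * c
sum-const zero    c = refl
sum-const (suc n) c = cong (c +_) (sum-const n c)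

sum-zero : ∀ {n} {f : Fin n → ℕ} → (∀ i → f i ≡ 0) → sum f ≡ 0
sum-zero {n} h = trans (sum-cong-≗ h) (trans (sum-const n 0) (*-zeroʳ n))

f≤sum : ∀ {n} (f : Fin n → ℕ) i → f i ≤ sum f
f≤sum f zero    = m≤m+n _ _
f≤sum f (suc i) = ≤-trans (f≤sum (f ∘ suc) i) (m≤n+m _ _)

sum-δ : ∀ {n} (x : Fin n) (f : Fin n → ℕ) → sum (λ i → δ x i * f i) ≡ f x
sum-δ {suc n} x f = begin
  sum g                                ≡⟨ sum-remove {i = x} g ⟩
  g x + sum (g ∘ punchIn x)            ≡⟨ cong₂ _+_ (trans (cong (_* f x) (δ-refl x)) (+-identityʳ _))
                                          (sum-zero λ i → cong (_* f (punchIn x i)) (δ-≢ (punchInᵢ≢i x i))) ⟩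
  f x + 0                              ≡⟨ +-identityʳ _ ⟩
  f x                                  ∎
  where
  open ≡-Reasoning
  g = λ i → δ x i * f i

sumᴸ : ∀ {n} → (Fin n → ℕ) → List (Fin n) → ℕ
sumᴸ f []      = 0
sumᴸ f (x ∷ L) = f x + sumᴸ f L

occ : ∀ {n} → List (Fin n) → Fin n → ℕ
occ []      i = 0
occ (x ∷ L) i = δ x i + occ L i

sum-occ : ∀ {n} (L : List (Fin n)) (f : Fin n → ℕ) → sum (λ i → occ L i * f i) ≡ sumᴸ f L
sum-occ {n} []      f = sum-zero {n} (λ _ → refl)
sum-occ {n} (x ∷ L) f = begin
  sum (λ i → (δ x i + occ L i) * f i)                      ≡⟨ sum-cong-≗ (λ i → *-distribʳ-+ (f i) (δ x i) (occ L i)) ⟩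
  sum (λ i → δ x i * f i + occ L i * f i)                  ≡⟨ ∑-distrib-+ (λ i → δ x i * f i) _ ⟩
  sum (λ i → δ x i * f i) + sum (λ i → occ L i * f i)      ≡⟨ cong₂ _+_ (sum-δ x f) (sum-occ L f) ⟩
  f x + sumᴸ f L                                           ∎
  where open ≡-Reasoning

occ-∉ : ∀ {n} {L : List (Fin n)} {i} → i ∉ L → occ L i ≡ 0
occ-∉ {L = []}    h = refl
occ-∉ {L = x ∷ L} h = cong₂ _+_ (δ-≢ (h ∘ here)) (occ-∉ (h ∘ there))

occ-∈ : ∀ {n} {L : List (Fin n)} {i} → i ∈ L → 1 ≤ occ L i
occ-∈ {L = x ∷ L} (here refl) = ≤-trans (≤-reflexive (sym (δ-refl x))) (m≤m+n _ _)
occ-∈ {L = x ∷ L} (there p)   = ≤-trans (occ-∈ p) (m≤n+m _ _)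

occ≤1 : ∀ {n} {L : List (Fin n)} → Unique L → ∀ i → occ L i ≤ 1
occ≤1 [] i = z≤n
occ≤1 {L = x ∷ L} (x∉ ∷ u) i with i ≟ x
... | yes refl = ≤-reflexive (cong suc (occ-∉ λ p → All.lookup x∉ p refl))
... | no _     = occ≤1 u i

sumᴸ≤sum : ∀ {n} {L : List (Fin n)} → Unique L → (f : Fin n → ℕ) → sumᴸ f L ≤ sum f
sumᴸ≤sum {L = L} u f = subst (_≤ sum f) (sum-occ L f)
  (sum-mono λ i → ≤-trans (*-monoˡ-≤ (f i) (occ≤1 u i)) (≤-reflexive (+-identityʳ (f i))))

sumᴸ-count : ∀ {n} {S : Fin n → Bool} {L} → All (λ i → S i ≡ true) L → sumᴸ (ind ∘ S) L ≡ length L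
sumᴸ-count []       = refl
sumᴸ-count (h ∷ hs) = cong₂ _+_ (cong ind h) (sumᴸ-count hs)

length≤count : ∀ {n} {S : Fin n → Bool} {L} → Unique L → All (λ i → S i ≡ true) L → length L ≤ count S
length≤count {S = S} u h = subst (_≤ count S) (sumᴸ-count h) (sumᴸ≤sum u (ind ∘ S))

length≤n : ∀ {n} {L : List (Fin n)} → Unique L → length L ≤ n
length≤n {n} {L} u = subst (length L ≤_) (trans (sum-const n 1) (*-identityʳ n))
  (length≤count {S = λ _ → true} u (All.universal (λ _ → refl) L))

count≤length : ∀ {n} {S : Fin n → Bool} (L : List (Fin n)) → (∀ i → S i ≡ true → i ∈ L) → count S ≤ length L
count≤length {S = S} L h = subst (count S ≤_) (trans (sum-occ L (λ _ → 1)) (len L)) (sum-mono pt)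
  where
  pt : ∀ i → ind (S i) ≤ occ L i * 1
  pt i with S i in eq
  ... | true  = subst (1 ≤_) (sym (*-identityʳ _)) (occ-∈ (h i eq))
  ... | false = z≤n
  len : ∀ L → sumᴸ (λ _ → 1) L ≡ length L
  len []      = refl
  len (_ ∷ L) = cong suc (len L)

pick : ∀ {n} (S : Fin n → Bool) (L : List (Fin n)) → length L < count S → ∃[ j ] (S j ≡ true × j ∉ L)
pick S L lt with any? (λ j → (S j Bool.≟ true) ×-dec ¬? (j ∈? L))
... | yes r = r
... | no h  = contradiction (count≤length L λ i Si → decidable-stable (i ∈? L) λ i∉ → h (i , Si , i∉)) (<⇒≱ lt)

pickFin : ∀ {n} (L : List (Fin n)) → length L < n → ∃[ j ] (j ∉ L)
pickFin {n} L lt = map₂ proj₂ (pick (λ _ → true) L (subst (length L <_) (sym (trans (sum-const n 1) (*-identityʳ n))) lt))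

cover : ∀ {n} {L : List (Fin n)} → Unique L → n ≤ length L → ∀ z → z ∈ L
cover {L = L} u le z with z ∈? L
... | yes p = p
... | no z∉ = contradiction (length≤n (All.tabulate (λ p e → z∉ (subst (_∈ L) (sym e) p)) ∷ u)) (<⇒≱ (s≤s le))

-- Cores and cycles

Two : ∀ {n} → (Fin n → Set) → Set
Two Q = ∃₂ λ p q → p ≢ q × Q p × Q q

Two-map : ∀ {n} {Q R : Fin n → Set} → (∀ {p} → Q p → R p) → Two Q → Two R
Two-map h (p , q , p≢q , Qp , Qq) = p , q , p≢q , h Qp , h Qq

Two-avoid : ∀ {n} {Q : Fin n → Set} x → Two Q → ∃[ p ] (p ≢ x × Q p)
Two-avoid x (p , q , p≢q , Qp , Qq) with p ≟ x
... | yes p≡x = q , (λ q≡x → p≢q (trans p≡x (sym q≡x))) , Qq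
... | no p≢x  = p , p≢x , Qp

-- A vertex set inducing minimum degree at least 2.  Such a set contains a cycle, and the
-- vertices of a cycle form such a set, so disjoint cycles can be traded for disjoint cores.
Core : ∀ {n} → Graph n → (Fin n → Set) → Set
Core G P = ∃ P × (∀ {v} → P v → Two (λ p → P p × Adj G v p))

Adj-sym : ∀ {n} (G : Graph n) {u v} → Adj G u v → Adj G v u
Adj-sym G {u} {v} h = trans (Graph.sym G v u) h

Adj-≢ : ∀ {n} (G : Graph n) {u v} → Adj G u v → u ≢ v
Adj-≢ G {u} h refl with () ← trans (sym (irrefl G u)) h

PathAdj-++ˡ : ∀ {n} {G : Graph n} xs {ys} → PathAdj G (xs ++ ys) → PathAdj G xs
PathAdj-++ˡ []           p       = []
PathAdj-++ˡ (x ∷ [])     p       = [ x ]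
PathAdj-++ˡ (x ∷ y ∷ xs) (a ∷ p) = a ∷ PathAdj-++ˡ (y ∷ xs) p

Unique-++ˡ : ∀ {n} (xs : List (Fin n)) {ys} → Unique (xs ++ ys) → Unique xs
Unique-++ˡ []       u       = []
Unique-++ˡ (x ∷ xs) (h ∷ u) = All.++⁻ˡ xs h ∷ Unique-++ˡ xs u

-- Grows a path inside the core at its head until the head has a neighbour further down the path.
grow : ∀ {n} {G : Graph n} {P : Fin n → Set} → Core G P → ∀ k x xs →
       length (x ∷ xs) + k ≡ suc n → Unique (x ∷ xs) → PathAdj G (x ∷ xs) → All P (x ∷ xs) →
       Σ (Cycle G) λ C → All P (verts C)
-- The fuel `k` is the number of vertices missing to `suc n`; without fuel the path would have more
-- than `n` distinct vertices.
grow {n} C zero x xs len u p a =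
  contradiction (length≤n u) (<⇒≱ (≤-reflexive (sym (trans (sym (+-identityʳ _)) len))))
grow {n} {G} {P} C (suc k) x [] len u p a@(Px ∷ [])
  with y , _ , _ , (Py , x~y) , _ ← proj₂ C Px =
  grow C k y (x ∷ []) len (((Adj-≢ G (Adj-sym G x~y)) ∷ []) ∷ u) (Adj-sym G x~y ∷ p) (Py ∷ a)
grow {n} {G} {P} C (suc k) x (y ∷ ys) len u@(x∉ ∷ _) p a@(Px ∷ _)
  with r , r≢y , Pr , x~r ← Two-avoid y (proj₂ C Px) | r ∈? ys
... | no r∉ = grow C k r (x ∷ y ∷ ys) (trans (sym (+-suc _ k)) len)
        ((Adj-≢ G (Adj-sym G x~r) ∷ r≢y ∷ All.tabulate λ { z∈ refl → r∉ z∈ }) ∷ u)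
        (Adj-sym G x~r ∷ p) (Pr ∷ a)
... | yes r∈ with as , bs , refl ← ∈-∃++ r∈ = record
        { first = x ; middle = y ∷ as ; last = r ; long = s≤s z≤n
        ; distinct = Unique-++ˡ (x ∷ y ∷ as ++ r ∷ []) (subst Unique split u)
        ; path = PathAdj-++ˡ (x ∷ y ∷ as ++ r ∷ []) (subst (PathAdj G) split p)
        ; closes = Adj-sym G x~r }
        , All.++⁻ˡ (x ∷ y ∷ as ++ r ∷ []) (subst (All P) split a)
  where
  split : x ∷ y ∷ as ++ r ∷ bs ≡ (x ∷ y ∷ as ++ r ∷ []) ++ bs
  split = cong (λ l → x ∷ y ∷ l) (sym (++-assoc as (r ∷ []) bs))

core⇒cycle : ∀ {n} {G : Graph n} {P : Fin n → Set} → Core G P → Σ (Cycle G) λ C → All P (verts C)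
core⇒cycle {n} C@((x , Px) , _) = grow C n x [] refl ([] ∷ []) [ x ] (Px ∷ [])

-- Induction along the path, `p` being the predecessor of the vertex in turn and `c` the vertex at
-- which the cycle closes. The last vertex has the neighbours `p` and `c`, which must differ; the
-- disjunction admits the initial call, where `p` is `c` but further vertices follow.
path-nbrs : ∀ {n} {G : Graph n} c p zs l → Unique (p ∷ zs ++ l ∷ []) → PathAdj G (p ∷ zs ++ l ∷ []) →
            Adj G l c → c ∉ (zs ++ l ∷ []) → p ≢ c ⊎ 1 ≤ length zs →
            All (λ z → Two (λ q → q ∈ (c ∷ p ∷ zs ++ l ∷ []) × Adj G z q)) (zs ++ l ∷ [])
path-nbrs {G = G} c p [] l u (p~l ∷ _) l~c c∉ (inj₁ p≢c) =
  (p , c , p≢c , (there (here refl) , Adj-sym G p~l) , (here refl , l~c)) ∷ []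
path-nbrs {G = G} c p (z ∷ zs) l ((p≢z ∷ p∉) ∷ u) (p~z ∷ π) l~c c∉ _ =
  (p , next , p≢next , (there (here refl) , Adj-sym G p~z) , (there (there (there next∈)) , z~next))
  ∷ All.map (Two-map λ { (here q≡ , a) → here q≡ , a ; (there q∈ , a) → there (there q∈) , a })
      (path-nbrs c z zs l u π l~c (λ h → c∉ (there h)) (inj₁ λ z≡c → c∉ (here (sym z≡c))))
  where
  head-next : ∀ ws → PathAdj G (z ∷ ws ++ l ∷ []) → ∃[ y ] (y ∈ (ws ++ l ∷ []) × Adj G z y)
  head-next []       (a ∷ _) = l , here refl , a
  head-next (w ∷ ws) (a ∷ _) = w , here refl , a
  next = proj₁ (head-next zs π)
  next∈ = proj₁ (proj₂ (head-next zs π))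
  z~next = proj₂ (proj₂ (head-next zs π))
  p≢next : p ≢ next
  p≢next e = All.lookup p∉ next∈ e

cycle⇒core : ∀ {n} {G : Graph n} (C : Cycle G) → Core G (_∈ verts C)
cycle⇒core {G = G} record { first = f ; middle = y ∷ ys ; last = l ; distinct = u@(f∉ ∷ (y∉ ∷ _)) ; path = p@(f~y ∷ _) ; closes = l~f } =
  (f , here refl) , λ { (here refl) → y , l , (λ y≡l → All.lookup y∉ l∈ y≡l) , (there (here refl) , f~y) , (there (there l∈) , Adj-sym G l~f)
                      ; (there v∈) → Two-map (λ { (here q≡ , a) → here q≡ , a ; (there q∈ , a) → q∈ , a })
                          (All.lookup (path-nbrs f f (y ∷ ys) l u p l~f (λ h → All.lookup f∉ h refl) (inj₂ (s≤s z≤n))) v∈) }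
  where
  l∈ : l ∈ (ys ++ l ∷ [])
  l∈ = ∈-++⁺ʳ ys (here refl)

DisjointCores : ∀ {n} → Graph n → Set₁
DisjointCores {n} G = Σ[ P ∈ (Fin n → Set) ] Σ[ Q ∈ (Fin n → Set) ] (Core G P × Core G Q × (∀ {v} → P v → Q v → ⊥))

cores⇒cycles : ∀ {n} {G : Graph n} → DisjointCores G → TwoDisjointCycles G
cores⇒cycles (P , Q , CP , CQ , disj) with C , aP ← core⇒cycle CP | D , aQ ← core⇒cycle CQ =
  C , D , All.map (λ Pv v∈ → disj Pv (All.lookup aQ v∈)) aP

-- Degree sums and forests

deg : ∀ {n} → Graph n → Fin n → ℕ
deg G v = count (adj G v)

degSum : ∀ {n} → Graph n → ℕ
degSum G = sum (deg G)

countᴸ : ∀ {A : Set} → (A → Bool) → List A → ℕ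
countᴸ p xs = length (filterᵇ p xs)

countᴸ-++ : ∀ {A : Set} (p : A → Bool) xs ys → countᴸ p (xs ++ ys) ≡ countᴸ p xs + countᴸ p ys
countᴸ-++ p []       ys = refl
countᴸ-++ p (x ∷ xs) ys with p x
... | true  = cong suc (countᴸ-++ p xs ys)
... | false = countᴸ-++ p xs ys

countᴸ-map : ∀ {A B : Set} (p : B → Bool) (f : A → B) xs → countᴸ p (map f xs) ≡ countᴸ (p ∘ f) xs
countᴸ-map p f []       = refl
countᴸ-map p f (x ∷ xs) with p (f x)
... | true  = cong suc (countᴸ-map p f xs)
... | false = countᴸ-map p f xs

countᴸ-tabulate : ∀ {A : Set} {n} (p : A → Bool) (f : Fin n → A) → countᴸ p (tabulate f) ≡ count (p ∘ f)
countᴸ-tabulate {n = zero}  p f = refl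
countᴸ-tabulate {n = suc n} p f with p (f zero)
... | true  = cong suc (countᴸ-tabulate p (f ∘ suc))
... | false = countᴸ-tabulate p (f ∘ suc)

countᴸ-product : ∀ {A B : Set} {m n} (p : A × B → Bool) (f : Fin m → A) (g : Fin n → B) →
  countᴸ p (cartesianProduct (tabulate f) (tabulate g)) ≡ sum (λ i → count (λ j → p (f i , g j)))
countᴸ-product {m = zero}  p f g = refl
countᴸ-product {m = suc m} p f g = begin
  countᴸ p (map (f zero ,_) (tabulate g) ++ rest)          ≡⟨ countᴸ-++ p (map (f zero ,_) (tabulate g)) rest ⟩
  countᴸ p (map (f zero ,_) (tabulate g)) + countᴸ p rest  ≡⟨ cong₂ _+_ (trans (countᴸ-map p (f zero ,_) (tabulate g)) (countᴸ-tabulate _ g)) (countᴸ-product p (f ∘ suc) g) ⟩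
  _ ∎
  where
  open ≡-Reasoning
  rest = cartesianProduct (tabulate (f ∘ suc)) (tabulate g)

degSum≡2edges : ∀ {n} (G : Graph n) → degSum G ≡ edgeCount G + edgeCount G
degSum≡2edges {n} G = begin
  sum (λ i → sum λ j → ind (adj G i j))                    ≡⟨ sum-cong-≗ (λ i → sum-cong-≗ (split i)) ⟩
  sum (λ i → sum λ j → up i j + up j i)                    ≡⟨ sum-cong-≗ (λ i → ∑-distrib-+ (up i) (λ j → up j i)) ⟩
  sum (λ i → sum (up i) + sum (λ j → up j i))              ≡⟨ ∑-distrib-+ (λ i → sum (up i)) (λ i → sum (λ j → up j i)) ⟩
  sum (λ i → sum (up i)) + sum (λ i → sum (λ j → up j i))  ≡⟨ cong (sum (λ i → sum (up i)) +_) (sym (∑-comm up)) ⟩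
  sum (λ i → sum (up i)) + sum (λ i → sum (up i))          ≡⟨ sym (cong₂ _+_ edges edges) ⟩
  edgeCount G + edgeCount G                                ∎
  where
  open ≡-Reasoning
  up : Fin n → Fin n → ℕ
  up i j = ind (⌊ i <ᶠ? j ⌋ ∧ adj G i j)
  edges : edgeCount G ≡ sum (λ i → sum (up i))
  edges = countᴸ-product (λ p → ⌊ proj₁ p <ᶠ? proj₂ p ⌋ ∧ adj G (proj₁ p) (proj₂ p)) id id
  split : ∀ i j → ind (adj G i j) ≡ up i j + up j i
  split i j with i <ᶠ? j | j <ᶠ? i
  ... | yes i<j | yes j<i = contradiction j<i (<-asym i<j)
  ... | yes i<j | no _    = sym (+-identityʳ _)
  ... | no _    | yes j<i = cong ind (Graph.sym G i j)
  ... | no i≮j  | no j≮i with refl ← toℕ-injective (≤-antisym (≮⇒≥ j≮i) (≮⇒≥ i≮j)) = cong ind (irrefl G i)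

nbrs : ∀ {n} → Graph n → (Fin n → ℕ) → Fin n → ℕ
nbrs G t i = sum λ j → t j * ind (adj G i j)

-- For the indicator s of a vertex set, W G s s is twice the number of edges inside the set.
W : ∀ {n} → Graph n → (Fin n → ℕ) → (Fin n → ℕ) → ℕ
W G s t = sum λ i → s i * nbrs G t i

nbrs-cong : ∀ {n} (G : Graph n) {s t : Fin n → ℕ} → (∀ i → s i ≡ t i) → ∀ i → nbrs G s i ≡ nbrs G t i
nbrs-cong G h i = sum-cong-≗ λ j → cong (_* ind (adj G i j)) (h j)

W-cong : ∀ {n} (G : Graph n) {s s′ t t′ : Fin n → ℕ} → (∀ i → s i ≡ s′ i) → (∀ i → t i ≡ t′ i) → W G s t ≡ W G s′ t′
W-cong G h k = sum-cong-≗ λ i → cong₂ _*_ (h i) (nbrs-cong G k i)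

nbrs-+ : ∀ {n} (G : Graph n) (s t : Fin n → ℕ) i → nbrs G (λ j → s j + t j) i ≡ nbrs G s i + nbrs G t i
nbrs-+ G s t i = trans (sum-cong-≗ λ j → *-distribʳ-+ (ind (adj G i j)) (s j) (t j))
                       (∑-distrib-+ (λ j → s j * ind (adj G i j)) (λ j → t j * ind (adj G i j)))

W-+ˡ : ∀ {n} (G : Graph n) s s′ t → W G (λ i → s i + s′ i) t ≡ W G s t + W G s′ t
W-+ˡ G s s′ t = trans (sum-cong-≗ λ i → *-distribʳ-+ (nbrs G t i) (s i) (s′ i))
                      (∑-distrib-+ (λ i → s i * nbrs G t i) (λ i → s′ i * nbrs G t i))

W-+ʳ : ∀ {n} (G : Graph n) s t t′ → W G s (λ i → t i + t′ i) ≡ W G s t + W G s t′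
W-+ʳ G s t t′ = trans (sum-cong-≗ λ i → trans (cong (s i *_) (nbrs-+ G t t′ i)) (*-distribˡ-+ (s i) _ _))
                      (∑-distrib-+ (λ i → s i * nbrs G t i) (λ i → s i * nbrs G t′ i))

W-comm : ∀ {n} (G : Graph n) s t → W G s t ≡ W G t s
W-comm {n} G s t = begin
  sum (λ i → s i * nbrs G t i)                          ≡⟨ sum-cong-≗ (λ i → sym (sum-*ˡ (s i) (λ j → t j * ind (adj G i j)))) ⟩
  sum (λ i → sum λ j → s i * (t j * ind (adj G i j)))   ≡⟨ ∑-comm (λ i j → s i * (t j * ind (adj G i j))) ⟩
  sum (λ j → sum λ i → s i * (t j * ind (adj G i j)))   ≡⟨ sum-cong-≗ (λ j → sum-cong-≗ λ i → swap i j) ⟩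
  sum (λ j → sum λ i → t j * (s i * ind (adj G j i)))   ≡⟨ sum-cong-≗ (λ j → sum-*ˡ (t j) (λ i → s i * ind (adj G j i))) ⟩
  sum (λ j → t j * nbrs G s j)                          ∎
  where
  open ≡-Reasoning
  swap : ∀ i j → s i * (t j * ind (adj G i j)) ≡ t j * (s i * ind (adj G j i))
  swap i j rewrite Graph.sym G i j = x∙yz≈y∙xz (s i) (t j) (ind (adj G j i))

W-δˡ : ∀ {n} (G : Graph n) x t → W G (δ x) t ≡ nbrs G t x
W-δˡ G x t = sum-δ x (nbrs G t)

degIn : ∀ {n} → Graph n → (Fin n → Bool) → Fin n → ℕ
degIn G S v = count λ j → S j ∧ adj G v j

nbrs-ind : ∀ {n} (G : Graph n) S v → nbrs G (ind ∘ S) v ≡ degIn G S v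
nbrs-ind G S v = sum-cong-≗ λ j → sym (ind-∧ (S j) (adj G v j))

∧-true : ∀ {a b} → a ∧ b ≡ true → a ≡ true × b ≡ true
∧-true {true} {true} _ = refl , refl

∧-intro : ∀ {a b} → a ≡ true → b ≡ true → a ∧ b ≡ true
∧-intro refl refl = refl

two-nbrs : ∀ {n} (G : Graph n) S v → 2 ≤ degIn G S v → Two (λ p → S p ≡ true × Adj G v p)
two-nbrs G S v h
  with p , hp , _ ← pick (λ j → S j ∧ adj G v j) [] (≤-trans (s≤s z≤n) h)
  with q , hq , q∉ ← pick (λ j → S j ∧ adj G v j) (p ∷ []) h =
  p , q , (λ p≡q → q∉ (here (sym p≡q))) , ∧-true hp , ∧-true hq

infixl 6 _∖_
_∖_ : ∀ {n} → (Fin n → Bool) → Fin n → Fin n → Bool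
(S ∖ v) i = S i ∧ not ⌊ i ≟ v ⌋

ind-∖ : ∀ {n} {S : Fin n → Bool} {v} → S v ≡ true → ∀ i → ind (S i) ≡ ind ((S ∖ v) i) + δ v i
ind-∖ {S = S} {v} Sv i with i ≟ v
... | yes refl rewrite Sv = refl
... | no _ with S i
...   | true  = refl
...   | false = refl

count-∖ : ∀ {n} {S : Fin n → Bool} {v} → S v ≡ true → count S ≡ suc (count (S ∖ v))
count-∖ {S = S} {v} Sv = begin
  count S                        ≡⟨ sum-cong-≗ (ind-∖ {S = S} Sv) ⟩
  sum (λ i → ind ((S ∖ v) i) + δ v i)  ≡⟨ ∑-distrib-+ (ind ∘ (S ∖ v)) (δ v) ⟩
  count (S ∖ v) + sum (δ v)      ≡⟨ cong (count (S ∖ v) +_) (trans (sum-cong-≗ λ i → sym (*-identityʳ (δ v i))) (sum-δ v (λ _ → 1))) ⟩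
  count (S ∖ v) + 1              ≡⟨ +-comm _ 1 ⟩
  suc (count (S ∖ v))            ∎
  where open ≡-Reasoning

∖-⊆ : ∀ {n} (S : Fin n → Bool) v {i} → (S ∖ v) i ≡ true → S i ≡ true
∖-⊆ S v h = proj₁ (∧-true h)

-- Bilinear expansion of the indicator of `S` as that of `S ∖ v` plus `δ v`: the two mixed terms
-- agree by symmetry, and the term in `δ v` alone counts loops.
W-∖ : ∀ {n} (G : Graph n) {S v} → S v ≡ true →
      W G (ind ∘ S) (ind ∘ S) ≡ W G (ind ∘ (S ∖ v)) (ind ∘ (S ∖ v)) + 2 * degIn G (S ∖ v) v
W-∖ G {S} {v} Sv = begin
  W G (ind ∘ S) (ind ∘ S)                              ≡⟨ W-cong G (ind-∖ {S = S} Sv) (ind-∖ {S = S} Sv) ⟩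
  W G (λ i → s i + δ v i) (λ i → s i + δ v i)          ≡⟨ W-+ˡ G s (δ v) (λ i → s i + δ v i) ⟩
  W G s (λ i → s i + δ v i) + W G (δ v) (λ i → s i + δ v i)
    ≡⟨ cong₂ _+_ (W-+ʳ G s s (δ v)) (W-+ʳ G (δ v) s (δ v)) ⟩
  (W G s s + W G s (δ v)) + (W G (δ v) s + W G (δ v) (δ v))
    ≡⟨ cong₂ _+_ (cong (W G s s +_) (trans (W-comm G s (δ v)) d)) (cong₂ _+_ d loop) ⟩
  (W G s s + degIn G (S ∖ v) v) + (degIn G (S ∖ v) v + 0)  ≡⟨ +-assoc (W G s s) _ _ ⟩
  W G s s + 2 * degIn G (S ∖ v) v                      ∎
  where
  open ≡-Reasoning
  s = ind ∘ (S ∖ v)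
  d : W G (δ v) s ≡ degIn G (S ∖ v) v
  d = trans (W-δˡ G v s) (nbrs-ind G (S ∖ v) v)
  loop : W G (δ v) (δ v) ≡ 0
  loop = trans (W-δˡ G v (δ v)) (trans (sum-δ v (ind ∘ adj G v)) (cong ind (irrefl G v)))

Acyclic : ∀ {n} → Graph n → (Fin n → Bool) → Set₁
Acyclic {n} G S = {P : Fin n → Set} → Core G P → (∀ {v} → P v → S v ≡ true) → ⊥

low-degree : ∀ {n} (G : Graph n) {S} {x} → S x ≡ true → Acyclic G S → ∃[ v ] (S v ≡ true × degIn G S v ≤ 1)
low-degree G {S} {x} Sx ac with any? (λ v → (S v Bool.≟ true) ×-dec (degIn G S v ≤? 1))
... | yes r = r
... | no h  = ⊥-elim (ac {λ v → S v ≡ true} ((x , Sx) , λ {v} Sv → two-nbrs G S v (≰⇒> λ le → h (v , Sv , le))) id)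

-- A forest on `suc k` vertices has at most `k` edges, each counted twice by `W`. A vertex of degree
-- at most 1 exists because `S` itself would otherwise be a core; deleting it loses at most one
-- edge.
forest-bound : ∀ {n} (G : Graph n) k {S} → count S ≡ suc k → Acyclic G S → W G (ind ∘ S) (ind ∘ S) + 2 ≤ 2 * suc k
forest-bound G k {S} cS ac
  with x , Sx , _ ← pick S [] (subst (0 <_) (sym cS) (s≤s z≤n))
  with v , Sv , d≤1 ← low-degree G {x = x} Sx ac = subst (λ w → w + 2 ≤ 2 * suc k) (sym (W-∖ G {S} Sv)) (go k cS′)
  where
  S′ = S ∖ v
  s′ = ind ∘ S′
  cS′ : count S′ ≡ k
  cS′ = suc-injective (trans (sym (count-∖ {S = S} Sv)) cS)
  d′≤d : degIn G S′ v ≤ degIn G S v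
  d′≤d = sum-mono λ j → le (S j) (not ⌊ j ≟ v ⌋) (adj G v j)
    where
    le : ∀ a b c → ind ((a ∧ b) ∧ c) ≤ ind (a ∧ c)
    le false b     c = z≤n
    le true  true  c = ≤-refl
    le true  false c = z≤n
  go : ∀ k → count S′ ≡ k → W G s′ s′ + 2 * degIn G S′ v + 2 ≤ 2 * suc k
  -- For the last vertex the estimate `d≤1` would be off by one edge; its degree is 0 because
  -- nothing else is left.
  go zero c0 = ≤-reflexive (cong₂ (λ a b → a + 2 * b + 2) W0 d0)
    where
    z : ∀ i → s′ i ≡ 0
    z i = n≤0⇒n≡0 (subst (s′ i ≤_) c0 (f≤sum s′ i))
    W0 : W G s′ s′ ≡ 0
    W0 = sum-zero λ i → cong (_* nbrs G s′ i) (z i)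
    d0 : degIn G S′ v ≡ 0
    d0 = trans (sym (nbrs-ind G S′ v)) (sum-zero λ j → cong (_* ind (adj G v j)) (z j))
  go (suc k) c = begin
    W G s′ s′ + 2 * degIn G S′ v + 2  ≤⟨ +-monoˡ-≤ 2 (+-monoʳ-≤ (W G s′ s′) (*-monoʳ-≤ 2 (≤-trans d′≤d d≤1))) ⟩
    W G s′ s′ + 2 + 2                 ≤⟨ +-monoˡ-≤ 2 (forest-bound G k {S′} c λ C sub → ac C (∖-⊆ S v ∘ sub)) ⟩
    2 * suc k + 2                     ≡⟨ lemma k ⟩
    2 * suc (suc k)                   ∎
    where
    open ≤-Reasoning
    lemma : ∀ k → 2 * suc k + 2 ≡ 2 * suc (suc k)
    lemma = solve-∀

-- Saturation in terms of cores

isYes⁻ : ∀ {A : Set} (d : Dec A) → ⌊ d ⌋ ≡ true → A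
isYes⁻ (yes a) _ = a

isYes⁺ : ∀ {A : Set} (d : Dec A) → A → ⌊ d ⌋ ≡ true
isYes⁺ (yes _) _ = refl
isYes⁺ (no h)  a = contradiction a h

mem : ∀ {n} → List (Fin n) → Fin n → Bool
mem L z = ⌊ z ∈? L ⌋

mem⁻ : ∀ {n} (L : List (Fin n)) {z} → mem L z ≡ true → z ∈ L
mem⁻ L {z} = isYes⁻ (z ∈? L)

mem⁺ : ∀ {n} (L : List (Fin n)) {z} → z ∈ L → mem L z ≡ true
mem⁺ L {z} = isYes⁺ (z ∈? L)

Core-map : ∀ {n} {G : Graph n} {P Q : Fin n → Set} → (∀ {v} → P v → Q v) → (∀ {v} → Q v → P v) → Core G P → Core G Q
Core-map f g ((x , Px) , h) = (x , f Px) , λ Qv → Two-map (λ { (Pp , a) → f Pp , a }) (h (g Qv))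

-- A set containing u and v that becomes a core once the edge uv is added.
record Joined {n} (G : Graph n) (u v : Fin n) : Set where
  field
    side  : Fin n → Bool
    u∈    : side u ≡ true
    v∈    : side v ≡ true
    u-nbr : ∃[ p ] (side p ≡ true × Adj G u p)
    v-nbr : ∃[ p ] (side p ≡ true × Adj G v p)
    inner : ∀ {z} → side z ≡ true → z ≢ u → z ≢ v → Two (λ p → side p ≡ true × Adj G z p)

-- What two disjoint cycles of `G + uv` leave behind in `G`: the one through the new edge becomes
-- `side`, the other one is a core of `G`. Both sets are Boolean, so membership in them can be
-- decided.
record Linked {n} (G : Graph n) (u v : Fin n) : Set where
  field
    joined : Joined G u v
  open Joined joined public
  field
    other : Fin n → Bool
    core  : Core G (λ z → other z ≡ true)
    disj  : ∀ {z} → side z ≡ true → other z ≡ true → ⊥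

record CoreSaturated {n} (G : Graph n) : Set₁ where
  field
    none : DisjointCores G → ⊥
    link : ∀ {u v} → u ≢ v → adj G u v ≡ false → Linked G u v

module _ {n} (G : Graph n) {u v : Fin n} (u≢v : u ≢ v) where

  private
    H = addEdge G u v u≢v

  addEdge-⊆ : ∀ {x y} → Adj G x y → Adj H x y
  addEdge-⊆ {x} {y} h rewrite h = refl

  addEdge-new : Adj H u v
  addEdge-new rewrite isYes⁺ (u ≟ u) refl | isYes⁺ (v ≟ v) refl = ∨-zeroʳ (adj G u v)

  addEdge-inv : ∀ {x y} → Adj H x y → Adj G x y ⊎ (x ≡ u × y ≡ v) ⊎ (x ≡ v × y ≡ u)
  addEdge-inv {x} {y} h with adj G x y | x ≟ u | y ≟ v | x ≟ v | y ≟ u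
  ... | true  | _     | _     | _     | _     = inj₁ refl
  ... | false | yes p | yes q | _     | _     = inj₂ (inj₁ (p , q))
  ... | false | yes _ | no _  | yes p | yes q = inj₂ (inj₂ (p , q))
  ... | false | no _  | _     | yes p | yes q = inj₂ (inj₂ (p , q))

  degSum-addEdge : degSum H ≤ degSum G + 2
  degSum-addEdge = begin
    sum (λ i → sum λ j → ind (adj H i j))
      ≤⟨ sum-mono (λ i → sum-mono λ j → ≤-trans (ind-∨ (adj G i j) _) (+-monoʳ-≤ (ind (adj G i j)) (new≤ i j))) ⟩
    sum (λ i → sum λ j → ind (adj G i j) + (δ u i * δ v j + δ v i * δ u j))
      ≡⟨ sum-cong-≗ (λ i → trans (∑-distrib-+ (ind ∘ adj G i) (λ j → δ u i * δ v j + δ v i * δ u j)) (cong (deg G i +_) (row i))) ⟩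
    sum (λ i → deg G i + (δ u i + δ v i))
      ≡⟨ trans (∑-distrib-+ (deg G) (λ i → δ u i + δ v i)) (cong (degSum G +_) (trans (∑-distrib-+ (δ u) (δ v)) (cong₂ _+_ (sum-δ₁ u) (sum-δ₁ v)))) ⟩
    degSum G + 2 ∎
    where
    open ≤-Reasoning
    ind-∨ : ∀ a b → ind (a ∨ b) ≤ ind a + ind b
    ind-∨ true  b = m≤m+n 1 _
    ind-∨ false b = ≤-refl
    new≤ : ∀ i j → ind ((⌊ i ≟ u ⌋ ∧ ⌊ j ≟ v ⌋) ∨ (⌊ i ≟ v ⌋ ∧ ⌊ j ≟ u ⌋)) ≤ δ u i * δ v j + δ v i * δ u j
    new≤ i j = ≤-trans (ind-∨ (⌊ i ≟ u ⌋ ∧ ⌊ j ≟ v ⌋) _)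
                       (≤-reflexive (cong₂ _+_ (ind-∧ ⌊ i ≟ u ⌋ _) (ind-∧ ⌊ i ≟ v ⌋ _)))
    sum-δ₁ : ∀ x → sum (δ x) ≡ 1
    sum-δ₁ x = trans (sum-cong-≗ λ i → sym (*-identityʳ (δ x i))) (sum-δ x (λ _ → 1))
    row : ∀ i → sum (λ j → δ u i * δ v j + δ v i * δ u j) ≡ δ u i + δ v i
    row i = trans (∑-distrib-+ (λ j → δ u i * δ v j) (λ j → δ v i * δ u j))
      (cong₂ _+_ (one u v) (one v u))
      where
      one : ∀ x y → sum (λ j → δ x i * δ y j) ≡ δ x i
      one x y = trans (sum-*ˡ (δ x i) (δ y)) (trans (cong (δ x i *_) (sum-δ₁ y)) (*-identityʳ _))

  private
    restrict : ∀ {P : Fin n → Set} → Core H P → ¬ (P u × P v) → Core G P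
    restrict {P} (ne , h) ¬uv = ne , λ Pz → Two-map (λ { (Pp , a) → Pp , old Pz Pp (addEdge-inv a) }) (h Pz)
      where
      old : ∀ {z p} → P z → P p → Adj G z p ⊎ (z ≡ u × p ≡ v) ⊎ (z ≡ v × p ≡ u) → Adj G z p
      old Pz Pp (inj₁ a)                  = a
      old Pz Pp (inj₂ (inj₁ (refl , refl))) = contradiction (Pz , Pp) ¬uv
      old Pz Pp (inj₂ (inj₂ (refl , refl))) = contradiction (Pp , Pz) ¬uv

    linked : (C D : Cycle H) → (∀ {z} → z ∈ verts C → z ∈ verts D → ⊥) → u ∈ verts C → v ∈ verts C → Linked G u v
    linked C D disj u∈C v∈C = record
      { joined = record
        { side = mem (verts C) ; u∈ = mem⁺ (verts C) u∈C ; v∈ = mem⁺ (verts C) v∈C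
        ; u-nbr = nbr u∈C v (λ { p≢v (inj₁ a) → a ; p≢v (inj₂ (inj₁ (_ , p≡v))) → contradiction p≡v p≢v
                               ; p≢v (inj₂ (inj₂ (u≡v , _))) → contradiction u≡v u≢v })
        ; v-nbr = nbr v∈C u (λ { p≢u (inj₁ a) → a ; p≢u (inj₂ (inj₁ (v≡u , _))) → contradiction (sym v≡u) u≢v
                               ; p≢u (inj₂ (inj₂ (_ , p≡u))) → contradiction p≡u p≢u })
        ; inner = λ z∈ z≢u z≢v → Two-map (λ { (p∈ , a) → mem⁺ (verts C) p∈ , old z≢u z≢v (addEdge-inv a) })
                                         (proj₂ (cycle⇒core C) (mem⁻ (verts C) z∈)) }
      ; other = mem (verts D)
      ; core = Core-map {G = G} (mem⁺ (verts D)) (mem⁻ (verts D))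
                 (restrict (cycle⇒core D) (λ h → disj u∈C (proj₁ h)))
      ; disj = λ zC zD → disj (mem⁻ (verts C) zC) (mem⁻ (verts D) zD) }
      where
      nbr : ∀ {z} → z ∈ verts C → ∀ y →
            (∀ {p} → p ≢ y → Adj G z p ⊎ (z ≡ u × p ≡ v) ⊎ (z ≡ v × p ≡ u) → Adj G z p) →
            ∃[ p ] (mem (verts C) p ≡ true × Adj G z p)
      nbr z∈ y f with p , p≢y , p∈ , a ← Two-avoid y (proj₂ (cycle⇒core C) z∈) =
        p , mem⁺ (verts C) p∈ , f p≢y (addEdge-inv a)
      old : ∀ {z p} → z ≢ u → z ≢ v → Adj G z p ⊎ (z ≡ u × p ≡ v) ⊎ (z ≡ v × p ≡ u) → Adj G z p
      old z≢u z≢v (inj₁ a)              = a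
      old z≢u z≢v (inj₂ (inj₁ (e , _))) = contradiction e z≢u
      old z≢u z≢v (inj₂ (inj₂ (e , _))) = contradiction e z≢v

  -- A cycle that lacks one of `u`, `v` cannot use the new edge. If this held for both cycles, they
  -- would already be disjoint cores of `G`.
  cycles⇒linked : (DisjointCores G → ⊥) → TwoDisjointCycles H → Linked G u v
  cycles⇒linked none (C , D , disj)
    with (u ∈? verts C) ×-dec (v ∈? verts C) | (u ∈? verts D) ×-dec (v ∈? verts D)
  ... | yes (uC , vC) | _ = linked C D (λ zC zD → All.lookup disj zC zD) uC vC
  ... | no _ | yes (uD , vD) = linked D C (λ zD zC → All.lookup disj zC zD) uD vD
  ... | no ¬C | no ¬D = ⊥-elim (none
        (_ , _ , restrict (cycle⇒core C) ¬C , restrict (cycle⇒core D) ¬D , λ zC zD → All.lookup disj zC zD))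

saturated⇒core : ∀ {n} {G : Graph n} → Saturated G → CoreSaturated G
saturated⇒core {G = G} (no2 , sat) = record
  { none = no2 ∘ cores⇒cycles
  ; link = λ u≢v ¬a → cycles⇒linked G u≢v (no2 ∘ cores⇒cycles) (sat _ _ u≢v ¬a) }

nbrs-1 : ∀ {n} (G : Graph n) i → nbrs G (λ _ → 1) i ≡ deg G i
nbrs-1 G i = sum-cong-≗ λ j → *-identityˡ (ind (adj G i j))

Two-count : ∀ {n} {S : Fin n → Bool} → Two (λ p → S p ≡ true) → 2 ≤ count S
Two-count (p , q , p≢q , Sp , Sq) = length≤count ((p≢q ∷ []) ∷ [] ∷ []) (Sp ∷ Sq ∷ [])

-- Writing 1 = d + f for the indicators d of D and f of its complement F, bilinearity gives
-- W 1 1 + W f f = W d d + 2 W f 1, and F induces a forest because it misses the core D.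
degSum-core : ∀ {n} {G : Graph n} → CoreSaturated G → (D : Fin n → Bool) → Core G (λ v → D v ≡ true) →
  (∀ v → D v ≡ false → 3 ≤ deg G v) → ∃[ v ] D v ≡ false →
  2 * count D + 4 * count (not ∘ D) + 2 ≤ degSum G
degSum-core {n} {G} sat D CD deg≥3 (v₀ , ¬Dv₀) = +-cancelʳ-≤ (W G f f + 2) _ _ (begin
  2 * cD + 4 * cF + 2 + (W G f f + 2)   ≤⟨ +-monoʳ-≤ (2 * cD + 4 * cF + 2) forest ⟩
  2 * cD + 4 * cF + 2 + 2 * cF          ≡⟨ lemma₁ cD cF ⟩
  2 * cD + 2 * (3 * cF) + 2             ≤⟨ +-monoˡ-≤ 2 (+-mono-≤ inside (*-monoʳ-≤ 2 outside)) ⟩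
  W G d d + 2 * W G f (λ _ → 1) + 2     ≡⟨ cong (_+ 2) identity ⟩
  degSum G + W G f f + 2                ≡⟨ +-assoc (degSum G) _ _ ⟩
  degSum G + (W G f f + 2)              ∎)
  where
  open ≤-Reasoning
  cD = count D
  F = not ∘ D
  cF = count F
  d = ind ∘ D
  f = ind ∘ F
  one : ∀ i → d i + f i ≡ 1
  one i = ind-not (D i)
  lemma₁ : ∀ a b → 2 * a + 4 * b + 2 + 2 * b ≡ 2 * a + 2 * (3 * b) + 2
  lemma₁ = solve-∀
  lemma₂ : ∀ a b c → a + 2 * (b + c) ≡ (a + b) + (b + c) + c
  lemma₂ = solve-∀
  split : ∀ s → W G s (λ _ → 1) ≡ W G s d + W G s f
  split s = trans (W-cong G {s = s} (λ _ → refl) (sym ∘ one)) (W-+ʳ G s d f)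
  identity : W G d d + 2 * W G f (λ _ → 1) ≡ degSum G + W G f f
  identity = begin-equality
    W G d d + 2 * W G f (λ _ → 1)                  ≡⟨ cong (λ w → W G d d + 2 * w) (split f) ⟩
    W G d d + 2 * (W G f d + W G f f)              ≡⟨ lemma₂ (W G d d) (W G f d) (W G f f) ⟩
    (W G d d + W G f d) + (W G f d + W G f f) + W G f f
      ≡⟨ cong (_+ W G f f) (cong₂ _+_ (cong (W G d d +_) (W-comm G f d)) refl) ⟩
    (W G d d + W G d f) + (W G f d + W G f f) + W G f f
      ≡⟨ cong (_+ W G f f) (sym (cong₂ _+_ (split d) (split f))) ⟩
    W G d (λ _ → 1) + W G f (λ _ → 1) + W G f f    ≡⟨ cong (_+ W G f f) (sym (W-+ˡ G d f (λ _ → 1))) ⟩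
    W G (λ i → d i + f i) (λ _ → 1) + W G f f
      ≡⟨ cong (_+ W G f f) (sum-cong-≗ λ i → trans (cong₂ _*_ (one i) (nbrs-1 G i)) (*-identityˡ _)) ⟩
    degSum G + W G f f                             ∎
  inside : 2 * cD ≤ W G d d
  inside = subst (_≤ W G d d) (sum-*ˡ 2 d) (sum-mono λ i → pt i (D i) refl)
    where
    pt : ∀ i b → D i ≡ b → 2 * ind b ≤ ind b * nbrs G d i
    pt i false e = z≤n
    pt i true  e = ≤-trans (subst (2 ≤_) (sym (nbrs-ind G D i))
        (Two-count (Two-map (λ { (Dp , a) → ∧-intro Dp a }) (proj₂ CD e)))) (≤-reflexive (sym (+-identityʳ _)))
  outside : 3 * cF ≤ W G f (λ _ → 1)
  outside = subst (_≤ W G f (λ _ → 1)) (sum-*ˡ 3 f) (sum-mono λ i → pt i (D i) refl)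
    where
    pt : ∀ i b → D i ≡ b → 3 * ind (not b) ≤ ind (not b) * nbrs G (λ _ → 1) i
    pt i true  e = z≤n
    pt i false e = ≤-trans (subst (3 ≤_) (sym (nbrs-1 G i)) (deg≥3 i e)) (≤-reflexive (sym (+-identityʳ _)))
  acyclicF : Acyclic G F
  acyclicF CP sub = CoreSaturated.none sat (_ , _ , CP , CD , λ Pv Dv → case trans (sym (cong not Dv)) (sub Pv) of λ ())
  v₀∈F : F v₀ ≡ true
  v₀∈F = cong not ¬Dv₀
  forest : W G f f + 2 ≤ 2 * cF
  forest = subst (λ c → W G f f + 2 ≤ 2 * c) (sym (count-∖ {S = F} v₀∈F))
    (forest-bound G (count (F ∖ v₀)) (count-∖ {S = F} v₀∈F) acyclicF)

-- Deleting a leaf and suppressing a vertex of degree 2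

del : ∀ {n} → Graph (suc n) → Fin (suc n) → Graph n
del G w = record
  { adj    = λ i j → adj G (punchIn w i) (punchIn w j)
  ; sym    = λ i j → Graph.sym G (punchIn w i) (punchIn w j)
  ; irrefl = λ i → irrefl G (punchIn w i) }

degSum-del : ∀ {n} (G : Graph (suc n)) w → degSum G ≡ degSum (del G w) + 2 * deg G w
degSum-del G w = begin
  degSum G                                                              ≡⟨ sum-remove {i = w} (deg G) ⟩
  deg G w + sum (λ i → deg G (punchIn w i))                             ≡⟨ cong (deg G w +_) (sum-cong-≗ λ i → sum-remove {i = w} (ind ∘ adj G (punchIn w i))) ⟩
  deg G w + sum (λ i → ind (adj G (punchIn w i) w) + deg (del G w) i)   ≡⟨ cong (deg G w +_) (∑-distrib-+ (λ i → ind (adj G (punchIn w i) w)) (deg (del G w))) ⟩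
  deg G w + (sum (λ i → ind (adj G (punchIn w i) w)) + degSum (del G w)) ≡⟨ cong (λ c → deg G w + (c + degSum (del G w))) column ⟩
  deg G w + (deg G w + degSum (del G w))                                ≡⟨ lemma (deg G w) (degSum (del G w)) ⟩
  degSum (del G w) + 2 * deg G w                                        ∎
  where
  open ≡-Reasoning
  column : sum (λ i → ind (adj G (punchIn w i) w)) ≡ deg G w
  column = trans (sum-cong-≗ λ i → cong ind (Graph.sym G (punchIn w i) w))
    (sym (trans (sum-remove {i = w} (ind ∘ adj G w)) (cong (λ b → ind b + sum (λ i → ind (adj G w (punchIn w i)))) (irrefl G w))))
  lemma : ∀ a b → a + (a + b) ≡ b + 2 * a
  lemma = solve-∀

punchIn-view : ∀ {n} (w z : Fin (suc n)) → z ≡ w ⊎ ∃[ i ] punchIn w i ≡ z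
punchIn-view w z with w ≟ z
... | yes w≡z = inj₁ (sym w≡z)
... | no w≢z  = inj₂ (punchOut w≢z , punchIn-punchOut w≢z)

Image : ∀ {n} → Fin (suc n) → (Fin n → Set) → Fin (suc n) → Set
Image w P z = ∃[ i ] (punchIn w i ≡ z × P i)

core-del⁻ : ∀ {n} {G : Graph (suc n)} w {P} → Core (del G w) P → Core G (Image w P)
core-del⁻ w ((x , Px) , h) = (punchIn w x , x , refl , Px) , λ { (i , refl , Pi) →
  case h Pi of λ { (p , q , p≢q , (Pp , a) , (Pq , b)) →
    punchIn w p , punchIn w q , p≢q ∘ punchIn-injective w p q , ((p , refl , Pp) , a) , ((q , refl , Pq) , b) } }

nbr-del⁺ : ∀ {n} {G : Graph (suc n)} w {P : Fin (suc n) → Set} {i} → ¬ P w →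
           ∃[ p ] (P p × Adj G (punchIn w i) p) → ∃[ j ] (P (punchIn w j) × Adj (del G w) i j)
nbr-del⁺ w ¬Pw (p , Pp , a) with punchIn-view w p
... | inj₁ refl       = contradiction Pp ¬Pw
... | inj₂ (j , refl) = j , Pp , a

two-del⁺ : ∀ {n} {G : Graph (suc n)} w {P : Fin (suc n) → Set} {i} → ¬ P w →
           Two (λ p → P p × Adj G (punchIn w i) p) → Two (λ j → P (punchIn w j) × Adj (del G w) i j)
two-del⁺ w ¬Pw (p , q , p≢q , (Pp , a) , (Pq , b)) with punchIn-view w p | punchIn-view w q
... | inj₁ refl       | _               = contradiction Pp ¬Pw
... | _               | inj₁ refl       = contradiction Pq ¬Pw
... | inj₂ (j , refl) | inj₂ (k , refl) = j , k , (λ { refl → p≢q refl }) , (Pp , a) , (Pq , b)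

core-del⁺ : ∀ {n} {G : Graph (suc n)} w {P} → ¬ P w → Core G P → Core (del G w) (P ∘ punchIn w)
core-del⁺ {G = G} w ¬Pw ((x , Px) , h) with punchIn-view w x
... | inj₁ refl       = contradiction Px ¬Pw
... | inj₂ (i , refl) = (i , Px) , λ Pv → two-del⁺ {G = G} w ¬Pw (h Pv)

joined-del⁺ : ∀ {n} {G : Graph (suc n)} w {u v} (J : Joined G (punchIn w u) (punchIn w v)) →
              ¬ (Joined.side J w ≡ true) → Joined (del G w) u v
joined-del⁺ {G = G} w J ¬s = record
  { side = side ∘ punchIn w ; u∈ = u∈ ; v∈ = v∈
  ; u-nbr = nbr-del⁺ {G = G} w ¬s u-nbr ; v-nbr = nbr-del⁺ {G = G} w ¬s v-nbr
  ; inner = λ z∈ z≢u z≢v → two-del⁺ {G = G} w ¬s (inner z∈ (z≢u ∘ punchIn-injective w _ _) (z≢v ∘ punchIn-injective w _ _)) }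
  where open Joined J

-- Both ends differ from `l`, so `l` would be an inner vertex of the side and have two neighbours.
leaf∉joined : ∀ {n} {G : Graph (suc n)} {l} → ¬ Two (Adj G l) → ∀ {u v} (J : Joined G (punchIn l u) (punchIn l v)) →
              ¬ (Joined.side J l ≡ true)
leaf∉joined {l = l} ¬2 {u} {v} J s = ¬2 (Two-map proj₂ (Joined.inner J s (punchInᵢ≢i l u ∘ sym) (punchInᵢ≢i l v ∘ sym)))

-- Neither a core nor the side of a pair of other vertices contains `l`, so all the data restrict to
-- the smaller graph.
remove-leaf : ∀ {n} {G : Graph (suc n)} {l} → CoreSaturated G → ¬ Two (Adj G l) → CoreSaturated (del G l)
remove-leaf {G = G} {l} sat ¬2 = record
  { none = λ { (P , Q , CP , CQ , d) → none (_ , _ , core-del⁻ {G = G} l CP , core-del⁻ {G = G} l CQ ,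
      λ { (i , refl , Pi) (j , e , Qj) → d Pi (subst Q (punchIn-injective l j i e) Qj) }) }
  ; link = λ {u} {v} u≢v ¬a → relink (link (u≢v ∘ punchIn-injective l u v) ¬a) }
  where
  open CoreSaturated sat
  relink : ∀ {u v} → Linked G (punchIn l u) (punchIn l v) → Linked (del G l) u v
  relink L = record
    { joined = joined-del⁺ l joined (leaf∉joined {G = G} ¬2 joined) ; other = other ∘ punchIn l
    ; core = core-del⁺ {G = G} l (λ o → ¬2 (Two-map proj₂ (proj₂ core o))) core ; disj = disj }
    where open Linked L

Nbrs : ∀ {n} → Graph n → Fin n → Fin n → Fin n → Set
Nbrs G w x y = Adj G w x × Adj G w y × x ≢ y × (∀ {z} → Adj G w z → z ≡ x ⊎ z ≡ y)

both-nbrs : ∀ {n} {G : Graph n} {w x y} {P : Fin n → Set} → Nbrs G w x y → Two (λ p → P p × Adj G w p) → P x × P y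
both-nbrs (_ , _ , _ , only) (p , q , p≢q , (Pp , a) , (Pq , b)) with only a | only b
... | inj₁ refl | inj₁ refl = contradiction refl p≢q
... | inj₁ refl | inj₂ refl = Pp , Pq
... | inj₂ refl | inj₁ refl = Pq , Pp
... | inj₂ refl | inj₂ refl = contradiction refl p≢q

-- Cores are carried both ways: `core-through` puts `w` back on the edge `xy`, and `core-contract`
-- replaces `w`, seen from one of its neighbours, by the other neighbour.
module Suppress {n} {G : Graph (suc n)} (sat : CoreSaturated G) {w : Fin (suc n)} {x y : Fin n}
                (N : Nbrs G w (punchIn w x) (punchIn w y)) (x≁y : adj (del G w) x y ≡ false) where

  private
    ι = punchIn w
    x≢y : x ≢ y
    x≢y e = proj₁ (proj₂ (proj₂ N)) (cong ι e)
    only = proj₂ (proj₂ (proj₂ N))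

  suppressed : Graph n
  suppressed = addEdge (del G w) x y x≢y

  -- Two edges at `w` disappear and at most one appears, so at least one edge is lost together with
  -- one vertex.
  degSum-suppressed : deg G w ≡ 2 → degSum suppressed + 2 ≤ degSum G
  degSum-suppressed d = begin
    degSum suppressed + 2          ≤⟨ +-monoˡ-≤ 2 (degSum-addEdge (del G w) x≢y) ⟩
    degSum (del G w) + 2 + 2       ≡⟨ +-assoc (degSum (del G w)) 2 2 ⟩
    degSum (del G w) + 2 * 2       ≡⟨ cong (λ k → degSum (del G w) + 2 * k) (sym d) ⟩
    degSum (del G w) + 2 * deg G w ≡⟨ sym (degSum-del G w) ⟩
    degSum G                       ∎
    where open ≤-Reasoning

  core-pull : ∀ {P} → ¬ P w → Core G P → Core suppressed (P ∘ ι)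
  core-pull ¬Pw C = map₂ (λ h Pv → Two-map (map₂ (addEdge-⊆ (del G w) x≢y)) (h Pv)) (core-del⁺ {G = G} w ¬Pw C)

  private
    xy : ∀ i j → Set
    xy i j = (i ≡ x × j ≡ y) ⊎ (i ≡ y × j ≡ x)

    -- A vertex has at most one neighbour along `xy`, so rerouting through `w` cannot merge two
    -- distinct neighbours.
    xy-det : ∀ {i j k} → xy i j → xy i k → j ≡ k
    xy-det (inj₁ (refl , refl)) (inj₁ (_ , refl)) = refl
    xy-det (inj₁ (refl , refl)) (inj₂ (e , _))    = contradiction e x≢y
    xy-det (inj₂ (refl , refl)) (inj₁ (e , _))    = contradiction (sym e) x≢y
    xy-det (inj₂ (refl , refl)) (inj₂ (_ , refl)) = refl

    xy-edge : ∀ {i j} → xy i j → Adj suppressed i j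
    xy-edge (inj₁ (refl , refl)) = addEdge-new (del G w) x≢y
    xy-edge (inj₂ (refl , refl)) = Adj-sym suppressed (addEdge-new (del G w) x≢y)

    -- This is where the non-adjacency of `x` and `y` enters: contraction could send `w` and an old
    -- neighbour to the same vertex only if `xy` had been an edge before.
    xy-nonadj : ∀ {i j} → xy i j → ¬ Adj (del G w) i j
    xy-nonadj (inj₁ (refl , refl)) a with () ← trans (sym a) x≁y
    xy-nonadj (inj₂ (refl , refl)) a with () ← trans (sym (Adj-sym (del G w) a)) x≁y

    -- The core of G obtained by routing the edge xy through w.
    Through : (Fin n → Set) → Fin (suc n) → Set
    Through P z = Image w P z ⊎ (z ≡ w × P x × P y)

    core-through : ∀ {P} → Core suppressed P → Core G (Through P)
    core-through {P} ((v₀ , Pv₀) , h) = (ι v₀ , inj₁ (v₀ , refl , Pv₀)) , λ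
      { (inj₁ (i , refl , Pi)) → two Pi (h Pi)
      ; (inj₂ (refl , Px , Py)) → ι x , ι y , x≢y ∘ punchIn-injective w x y
          , (inj₁ (x , refl , Px) , proj₁ N) , (inj₁ (y , refl , Py) , proj₁ (proj₂ N)) }
      where
      step : ∀ {i p} → P i → P p → Adj suppressed i p →
             ∃[ z ] (Through P z × Adj G (ι i) z × (z ≡ ι p ⊎ (z ≡ w × xy i p)))
      step {i} {p} Pi Pp a with addEdge-inv (del G w) x≢y a
      ... | inj₁ b                    = ι p , inj₁ (p , refl , Pp) , b , inj₁ refl
      ... | inj₂ (inj₁ (refl , refl)) = w , inj₂ (refl , Pi , Pp) , Adj-sym G (proj₁ N) , inj₂ (refl , inj₁ (refl , refl))
      ... | inj₂ (inj₂ (refl , refl)) = w , inj₂ (refl , Pp , Pi) , Adj-sym G (proj₁ (proj₂ N)) , inj₂ (refl , inj₂ (refl , refl))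
      two : ∀ {i} → P i → Two (λ p → P p × Adj suppressed i p) → Two (λ z → Through P z × Adj G (ι i) z)
      two {i} Pi (p , q , p≢q , (Pp , a) , (Pq , b)) with step Pi Pp a | step Pi Pq b
      ... | z , Tz , c , ez | z′ , Tz′ , c′ , ez′ = z , z′ , differ ez ez′ , (Tz , c) , (Tz′ , c′)
        where
        differ : (z ≡ ι p ⊎ (z ≡ w × xy i p)) → (z′ ≡ ι q ⊎ (z′ ≡ w × xy i q)) → z ≢ z′
        differ (inj₁ refl)       (inj₁ refl)       e = p≢q (punchIn-injective w p q e)
        differ (inj₁ refl)       (inj₂ (refl , _)) e = punchInᵢ≢i w p e
        differ (inj₂ (refl , _)) (inj₁ refl)       e = punchInᵢ≢i w q (sym e)
        differ (inj₂ (_ , s))    (inj₂ (_ , t))    e = p≢q (xy-det s t)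

    -- Serves cores and sides of linked pairs alike: either contains `x` and `y` as soon as it
    -- contains `w`.
    module Contract {S : Fin (suc n) → Bool} (closed : S w ≡ true → S (ι x) ≡ true × S (ι y) ≡ true) where

      nbr : ∀ {i p} → S p ≡ true → Adj G (ι i) p →
            ∃[ j ] (S (ι j) ≡ true × Adj suppressed i j × ((p ≡ ι j × Adj (del G w) i j) ⊎ (p ≡ w × xy i j)))
      nbr {i} {p} Sp a with punchIn-view w p
      ... | inj₂ (j , refl) = j , Sp , addEdge-⊆ (del G w) x≢y a , inj₁ (refl , a)
      ... | inj₁ refl with only (Adj-sym G a)
      ...   | inj₁ e = y , proj₂ (closed Sp) , xy-edge s , inj₂ (refl , s)
        where s = inj₁ (punchIn-injective w i x e , refl)
      ...   | inj₂ e = x , proj₁ (closed Sp) , xy-edge s , inj₂ (refl , s)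
        where s = inj₂ (punchIn-injective w i y e , refl)

      one : ∀ {i} → ∃[ p ] (S p ≡ true × Adj G (ι i) p) → ∃[ j ] (S (ι j) ≡ true × Adj suppressed i j)
      one (p , Sp , a) with j , Sj , b , _ ← nbr Sp a = j , Sj , b

      two : ∀ {i} → Two (λ p → S p ≡ true × Adj G (ι i) p) → Two (λ j → S (ι j) ≡ true × Adj suppressed i j)
      two {i} (p , q , p≢q , (Sp , a) , (Sq , b)) with nbr Sp a | nbr Sq b
      ... | j , Sj , c , ej | k , Sk , d , ek = j , k , differ ej ek , (Sj , c) , (Sk , d)
        where
        differ : ((p ≡ ι j × Adj (del G w) i j) ⊎ (p ≡ w × xy i j)) →
                 ((q ≡ ι k × Adj (del G w) i k) ⊎ (q ≡ w × xy i k)) → j ≢ k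
        differ (inj₁ (refl , _)) (inj₁ (refl , _)) e    = p≢q (cong ι e)
        differ (inj₁ (_ , a))    (inj₂ (_ , s))    refl = xy-nonadj s a
        differ (inj₂ (_ , s))    (inj₁ (_ , a))    refl = xy-nonadj s a
        differ (inj₂ (refl , _)) (inj₂ (refl , _)) e    = p≢q refl

    core-contract : ∀ {S} → Core G (λ z → S z ≡ true) → Core suppressed (λ i → S (ι i) ≡ true)
    core-contract {S} ((v , Sv) , h) = start (punchIn-view w v) , λ Si → two (h Si)
      where
      closed : S w ≡ true → S (ι x) ≡ true × S (ι y) ≡ true
      closed Sw = both-nbrs {G = G} N (h Sw)
      open Contract {S} closed
      start : v ≡ w ⊎ ∃[ i ] ι i ≡ v → ∃[ i ] S (ι i) ≡ true
      start (inj₁ refl)       = x , proj₁ (closed Sv)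
      start (inj₂ (i , refl)) = i , Sv

  suppress : CoreSaturated suppressed
  suppress = record
    { none = λ { (P , Q , CP , CQ , d) → none (_ , _ , core-through CP , core-through CQ , λ
        { (inj₁ (i , refl , Pi)) (inj₁ (j , e , Qj)) → d Pi (subst Q (punchIn-injective w j i e) Qj)
        ; (inj₁ (i , refl , Pi)) (inj₂ (e , _)) → punchInᵢ≢i w i e
        ; (inj₂ (refl , _)) (inj₁ (j , e , _)) → punchInᵢ≢i w j e
        ; (inj₂ (_ , Px , _)) (inj₂ (_ , Qx , _)) → d Px Qx }) }
    ; link = λ {u} {v} u≢v ¬a →
        let L = link (u≢v ∘ punchIn-injective w u v) (≢true⇒≡false λ a → case trans (sym (addEdge-⊆ (del G w) x≢y {u} {v} a)) ¬a of λ ())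
        in relink L }
    where
    open CoreSaturated sat
    relink : ∀ {u v} → Linked G (ι u) (ι v) → Linked suppressed u v
    relink {u} {v} L = record
      { joined = record
        { side = side ∘ ι ; u∈ = u∈ ; v∈ = v∈ ; u-nbr = one u-nbr ; v-nbr = one v-nbr
        ; inner = λ z∈ z≢u z≢v → two (inner z∈ (z≢u ∘ punchIn-injective w _ _) (z≢v ∘ punchIn-injective w _ _)) }
      ; other = other ∘ ι ; core = core-contract core ; disj = disj }
      where
      open Linked L
      open Contract {side} (λ Sw → both-nbrs {G = G} N (inner Sw (punchInᵢ≢i w u ∘ sym) (punchInᵢ≢i w v ∘ sym)))

-- Graphs on six vertices

-- Adjacency matrices given by their strict upper triangle, for exhaustive search.
Upper : ℕ → Set
Upper zero    = ⊤
Upper (suc n) = Vec Bool n × Upper n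

adjᵁ : ∀ {n} → Upper n → Fin n → Fin n → Bool
adjᵁ (r , U) zero    zero    = false
adjᵁ (r , U) zero    (suc j) = lookup r j
adjᵁ (r , U) (suc i) zero    = lookup r i
adjᵁ (r , U) (suc i) (suc j) = adjᵁ U i j

upper : ∀ {n} → (Fin n → Fin n → Bool) → Upper n
upper {zero}  f = tt
upper {suc n} f = Vec.tabulate (f zero ∘ suc) , upper (λ i j → f (suc i) (suc j))

adjᵁ-upper : ∀ {n} (f : Fin n → Fin n → Bool) → (∀ i j → f i j ≡ f j i) → (∀ i → f i i ≡ false) →
             ∀ i j → adjᵁ (upper f) i j ≡ f i j
adjᵁ-upper f s r zero    zero    = sym (r zero)
adjᵁ-upper f s r zero    (suc j) = lookup∘tabulate (f zero ∘ suc) j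
adjᵁ-upper f s r (suc i) zero    = trans (lookup∘tabulate (f zero ∘ suc) i) (s zero (suc i))
adjᵁ-upper f s r (suc i) (suc j) = adjᵁ-upper (λ i j → f (suc i) (suc j)) (λ i j → s (suc i) (suc j)) (r ∘ suc) i j

ones : ∀ {n} → Vec Bool n → ℕ
ones []      = 0
ones (b ∷ v) = ind b + ones v

edges : ∀ {n} → Upper n → ℕ
edges {zero}  tt      = 0
edges {suc n} (r , U) = ones r + edges U

-- The budget `k` prunes the search tree: once it is spent, only `false` entries are tried.
allVec? : ∀ n k {P : Vec Bool n → Set} → (∀ v → Dec (P v)) → Dec (∀ v → ones v ≤ k → P v)
allVec? zero    k       P? = map′ (λ { p [] _ → p }) (λ f → f [] z≤n) (P? [])
allVec? (suc n) zero    P? = map′ (λ { f (false ∷ v) → f v }) (λ f → f ∘ (false ∷_)) (allVec? n 0 (P? ∘ (false ∷_)))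
allVec? (suc n) (suc k) P? =
  map′ (λ { (f , g) (true ∷ v) le → f v (s≤s⁻¹ le) ; (f , g) (false ∷ v) → g v })
       (λ f → (λ v le → f (true ∷ v) (s≤s le)) , f ∘ (false ∷_))
       (allVec? n k (P? ∘ (true ∷_)) ×-dec allVec? n (suc k) (P? ∘ (false ∷_)))

allUpper? : ∀ n k {P : Upper n → Set} → (∀ U → Dec (P U)) → Dec (∀ U → edges U ≤ k → P U)
allUpper? zero    k P? = map′ (λ { p tt _ → p }) (λ f → f tt z≤n) (P? tt)
allUpper? (suc n) k P? = map′
  (λ f (r , U) le → f r (≤-trans (m≤m+n _ _) le) U (m+n≤o⇒m≤o∸n (edges U) (subst (_≤ k) (+-comm (ones r) (edges U)) le)))
  (λ f r le U le′ → f (r , U) (≤-trans (+-monoʳ-≤ (ones r) le′) (≤-reflexive (m+[n∸m]≡n le))))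
  (allVec? n k λ r → allUpper? n (k ∸ ones r) λ U → P? (r , U))

matrixSum : ∀ {n} → (Fin n → Fin n → Bool) → ℕ
matrixSum A = sum λ i → count (A i)

ones-count : ∀ {n} (v : Vec Bool n) → count (lookup v) ≡ ones v
ones-count []      = refl
ones-count (b ∷ v) = cong (ind b +_) (ones-count v)

matrixSum-edges : ∀ {n} (U : Upper n) → matrixSum (adjᵁ U) ≡ 2 * edges U
matrixSum-edges {zero}  tt      = refl
matrixSum-edges {suc n} (r , U) = begin
  count (lookup r) + sum (λ i → ind (lookup r i) + count (adjᵁ U i))
    ≡⟨ cong (count (lookup r) +_) (∑-distrib-+ (ind ∘ lookup r) (λ i → count (adjᵁ U i))) ⟩
  count (lookup r) + (count (lookup r) + matrixSum (adjᵁ U))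
    ≡⟨ cong₂ (λ a b → a + (a + b)) (ones-count r) (matrixSum-edges U) ⟩
  ones r + (ones r + 2 * edges U)   ≡⟨ lemma (ones r) (edges U) ⟩
  2 * (ones r + edges U)            ∎
  where
  open ≡-Reasoning
  lemma : ∀ a b → a + (a + 2 * b) ≡ 2 * (a + b)
  lemma = solve-∀

Out : ∀ {n} → Fin n → Fin n → Fin n → Fin n → Set
Out a b c i = i ≢ a × i ≢ b × i ≢ c

out? : ∀ {n} (a b c i : Fin n) → Dec (Out a b c i)
out? a b c i = ¬? (i ≟ a) ×-dec ¬? (i ≟ b) ×-dec ¬? (i ≟ c)

-- On six vertices two disjoint cycles are two triangles, here `u m v` after adding `uv` and the
-- triangle on the remaining vertices. Describing the latter as a complement leaves only `m` to be
-- searched for.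
record Split {n} (A : Fin n → Fin n → Bool) (u v m : Fin n) : Set where
  constructor mkSplit
  field
    um   : A u m ≡ true
    vm   : A v m ≡ true
    rest : ∀ i → Out u m v i → ∀ j → Out u m v j → i ≢ j → A i j ≡ true

split? : ∀ {n} (A : Fin n → Fin n → Bool) u v m → Dec (Split A u v m)
split? A u v m = map′ (λ (um , vm , r) → mkSplit um vm r) (λ (mkSplit um vm r) → um , vm , r)
  ((A u m Bool.≟ true) ×-dec (A v m Bool.≟ true) ×-dec
   all? λ i → out? u m v i →-dec all? λ j → out? u m v j →-dec ¬? (i ≟ j) →-dec (A i j Bool.≟ true))

AllSplit : ∀ {n} → (Fin n → Fin n → Bool) → Set
AllSplit A = ∀ u v → u ≢ v → A u v ≡ false → ∃ (Split A u v)

-- On six vertices the rim is then 2-regular on five vertices, hence a 5-cycle.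
WheelMatrix : ∀ {n} → (Fin n → Fin n → Bool) → Fin n → Set
WheelMatrix A h = ∀ v → v ≢ h → A h v ≡ true × count (A v) ≡ 3

-- The matrix of the graph on 0, …, 5 with path 0 1 2, non-edge 02, triangle 3 4 5 and the
-- edges between path and triangle given by x, y, z.
path+triangle : Vec Bool 3 → Vec Bool 3 → Vec Bool 3 → Upper 6
path+triangle x y z = true ∷ false ∷ x , true ∷ y , z , true ∷ true ∷ [] , true ∷ [] , [] , tt

-- One split pair fixes six of the fifteen entries, so only 512 matrices remain. The bound 20 stands
-- for ten edges.
wheel-search : ∀ x → ones x ≤ 3 → ∀ y → ones y ≤ 3 → ∀ z → ones z ≤ 3 →
  let A = adjᵁ {6} (path+triangle x y z) in matrixSum A ≤ 20 → AllSplit A → ∃ (WheelMatrix A)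
wheel-search = from-yes (allVec? 3 3 λ x → allVec? 3 3 λ y → allVec? 3 3 λ z → check (adjᵁ (path+triangle x y z)))
  where
  check : (A : Fin 6 → Fin 6 → Bool) → Dec (matrixSum A ≤ 20 → AllSplit A → ∃ (WheelMatrix A))
  check A = (matrixSum A ≤? 20) →-dec
    (all? λ u → all? λ v → ¬? (u ≟ v) →-dec (A u v Bool.≟ false) →-dec any? (split? A u v)) →-dec
    any? λ h → all? λ v → ¬? (v ≟ h) →-dec ((A h v Bool.≟ true) ×-dec (count (A v) Nat.≟ 3))

-- In the tree left by deleting a hub of a saturated graph on seven vertices, any two
-- non-adjacent vertices u, v are joined by a path missing both ends of some edge bc.
Joins : ∀ {n} → (Fin n → Fin n → Bool) → Fin n → Fin n → Set
Joins A u v = ∃[ m ] (A u m ≡ true × m ≢ v × ∃[ k ] (A v k ≡ true × k ≢ u × (m ≡ k ⊎ A m k ≡ true) ×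
  ∃[ b ] (b ∉ (u ∷ v ∷ m ∷ k ∷ []) × ∃[ c ] (A b c ≡ true × c ∉ (u ∷ v ∷ m ∷ k ∷ [])))))

joins? : ∀ {n} (A : Fin n → Fin n → Bool) u v → Dec (Joins A u v)
joins? A u v = any? λ m → (A u m Bool.≟ true) ×-dec ¬? (m ≟ v) ×-dec any? λ k → (A v k Bool.≟ true) ×-dec ¬? (k ≟ u) ×-dec
  ((m ≟ k) ⊎-dec (A m k Bool.≟ true)) ×-dec any? λ b → ¬? (b ∈? (u ∷ v ∷ m ∷ k ∷ [])) ×-dec
  any? λ c → (A b c Bool.≟ true) ×-dec ¬? (c ∈? (u ∷ v ∷ m ∷ k ∷ []))

AllJoin : ∀ {n} → (Fin n → Fin n → Bool) → Set
AllJoin A = ∀ u v → u ≢ v → A u v ≡ false → Joins A u v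

-- Five is what remains of the `7 + 4` edges once a hub has taken six of them.
joins-search : ∀ (U : Upper 6) → edges U ≤ 5 → ¬ AllJoin (adjᵁ U)
joins-search = from-yes (allUpper? 6 5 λ U →
  ¬? (all? λ u → all? λ v → ¬? (u ≟ v) →-dec (adjᵁ U u v Bool.≟ false) →-dec joins? (adjᵁ U) u v))

PathTriangle : ∀ {n} → Graph n → Fin n → Fin n → Set
PathTriangle G u v = ∃[ m ] ∃[ s ] ∃[ q ] ∃[ r ] (Unique (u ∷ m ∷ v ∷ s ∷ q ∷ r ∷ []) ×
  (Adj G u m × Adj G v m) × (Adj G s q × Adj G s r × Adj G q r))

-- On six vertices both sides of a `Linked` pair have exactly three vertices.
path-triangle : ∀ {G : Graph 6} {u v} → u ≢ v → adj G u v ≡ false → Linked G u v → PathTriangle G u v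
path-triangle {G} {u} {v} u≢v u≁v L
  with m , Sm , u~m ← Linked.u-nbr L | k , Sk , v~k ← Linked.v-nbr L
  with (s , Os) , tw ← Linked.core L
  with q , r , q≢r , (Oq , s~q) , (Or , s~r) ← tw Os
  with q′ , q′≢s , Oq′ , q~q′ ← Two-avoid s (tw Oq) =
  m , s , q , r , six , (u~m , v~m) , (s~q , s~r , q~r)
  where
  open Linked L
  apart : ∀ {a b} → side a ≡ true → other b ≡ true → a ≢ b
  apart Sa Ob refl = disj Sa Ob
  m≢v : m ≢ v
  m≢v refl with () ← trans (sym u~m) u≁v
  k≢u : k ≢ u
  k≢u refl with () ← trans (sym (Adj-sym G v~k)) u≁v
  six : Unique (u ∷ m ∷ v ∷ s ∷ q ∷ r ∷ [])
  six = (Adj-≢ G u~m ∷ u≢v ∷ apart u∈ Os ∷ apart u∈ Oq ∷ apart u∈ Or ∷ [])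
      ∷ (m≢v ∷ apart Sm Os ∷ apart Sm Oq ∷ apart Sm Or ∷ [])
      ∷ (apart v∈ Os ∷ apart v∈ Oq ∷ apart v∈ Or ∷ [])
      ∷ (Adj-≢ G s~q ∷ Adj-≢ G s~r ∷ [])
      ∷ (q≢r ∷ []) ∷ [] ∷ []
  all : ∀ z → z ∈ (u ∷ m ∷ v ∷ s ∷ q ∷ r ∷ [])
  all = cover six ≤-refl
  v~m : Adj G v m
  v~m with all k
  ... | here e                          = contradiction e k≢u
  ... | there (here refl)               = v~k
  ... | there (there (here e))          = contradiction (sym e) (Adj-≢ G v~k)
  ... | there (there (there (here refl)))                 = ⊥-elim (disj Sk Os)
  ... | there (there (there (there (here refl))))         = ⊥-elim (disj Sk Oq)
  ... | there (there (there (there (there (here refl))))) = ⊥-elim (disj Sk Or)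
  q~r : Adj G q r
  q~r with all q′
  ... | here refl                       = ⊥-elim (disj u∈ Oq′)
  ... | there (here refl)               = ⊥-elim (disj Sm Oq′)
  ... | there (there (here refl))       = ⊥-elim (disj v∈ Oq′)
  ... | there (there (there (here e)))  = contradiction e q′≢s
  ... | there (there (there (there (here e))))            = contradiction (sym e) (Adj-≢ G q~q′)
  ... | there (there (there (there (there (here refl))))) = q~q′

path-triangle⇒split : ∀ {G : Graph 6} {u v} → PathTriangle G u v → ∃ (Split (adj G) u v)
path-triangle⇒split {G} {u} {v} (m , s , q , r , six , (u~m , v~m) , (s~q , s~r , q~r)) = m , mkSplit u~m v~m triangle
  where
  in-triangle : ∀ {z} → Out u m v z → z ∈ (s ∷ q ∷ r ∷ [])
  in-triangle {z} (z≢u , z≢m , z≢v) with cover six ≤-refl z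
  ... | here e                  = contradiction e z≢u
  ... | there (here e)          = contradiction e z≢m
  ... | there (there (here e))  = contradiction e z≢v
  ... | there (there (there p)) = p
  triangle : ∀ i → Out u m v i → ∀ j → Out u m v j → i ≢ j → Adj G i j
  triangle i hi j hj i≢j with in-triangle hi | in-triangle hj
  ... | here refl                 | here refl                 = contradiction refl i≢j
  ... | here refl                 | there (here refl)         = s~q
  ... | here refl                 | there (there (here refl)) = s~r
  ... | there (here refl)         | here refl                 = Adj-sym G s~q
  ... | there (here refl)         | there (here refl)         = contradiction refl i≢j
  ... | there (here refl)         | there (there (here refl)) = q~r
  ... | there (there (here refl)) | here refl                 = Adj-sym G s~r
  ... | there (there (here refl)) | there (here refl)         = Adj-sym G q~r
  ... | there (there (here refl)) | there (there (here refl)) = contradiction refl i≢j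

lookup-injective : ∀ {n} {L : List (Fin n)} → Unique L → ∀ i j → List.lookup L i ≡ List.lookup L j → i ≡ j
lookup-injective (_ ∷ _)  zero    zero    e = refl
lookup-injective (x∉ ∷ _) zero    (suc j) e = contradiction e (All.lookup x∉ (∈-lookup j))
lookup-injective (x∉ ∷ _) (suc i) zero    e = contradiction (sym e) (All.lookup x∉ (∈-lookup i))
lookup-injective (_ ∷ u)  (suc i) (suc j) e = cong suc (lookup-injective u i j e)

sumᴸ-lookup : ∀ {n} (f : Fin n → ℕ) (L : List (Fin n)) → sum (f ∘ List.lookup L) ≡ sumᴸ f L
sumᴸ-lookup f []      = refl
sumᴸ-lookup f (x ∷ L) = cong (f x +_) (sumᴸ-lookup f L)

sum-relabel : ∀ {n} {L : List (Fin n)} → Unique L → (∀ z → z ∈ L) → (f : Fin n → ℕ) → sum (f ∘ List.lookup L) ≡ sum f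
sum-relabel {L = L} u all f = trans (sumᴸ-lookup f L) (trans (sym (sum-occ L f))
  (sum-cong-≗ λ i → trans (cong (_* f i) (≤-antisym (occ≤1 u i) (occ-∈ (all i)))) (*-identityˡ (f i))))

Wheel : ∀ {n} → Graph n → Fin n → Set
Wheel G h = ∀ {v} → v ≢ h → Adj G h v × deg G v ≡ 3

ones≤ : ∀ {n} (v : Vec Bool n) → ones v ≤ n
ones≤ []          = z≤n
ones≤ (true ∷ v)  = s≤s (ones≤ v)
ones≤ (false ∷ v) = m≤n⇒m≤1+n (ones≤ v)

-- The six named vertices serve as a relabelling `w`, under which the adjacency matrix takes the
-- form that was searched.
path-triangle⇒wheel : ∀ {G : Graph 6} {u v} → AllSplit (adj G) → degSum G ≤ 20 → adj G u v ≡ false → PathTriangle G u v →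
                      ∃[ h ] Wheel G h
path-triangle⇒wheel {G} {u} {v} splits small u≁v (m , s , q , r , six , (u~m , v~m) , (s~q , s~r , q~r)) =
  wheel (wheel-search x (ones≤ x) y (ones≤ y) z (ones≤ z)
    (subst (_≤ 20) (sym (trans (sum-cong-≗ count-A) (sum-relabel six all (deg G)))) small) split-A)
  where
  L = u ∷ m ∷ v ∷ s ∷ q ∷ r ∷ []
  w = List.lookup L
  all : ∀ z → z ∈ L
  all = cover six ≤-refl
  B : Fin 6 → Fin 6 → Bool
  B i j = adj G (w i) (w j)
  row : Fin 6 → Vec Bool 3
  row i = B i (suc (suc (suc zero))) ∷ B i (suc (suc (suc (suc zero)))) ∷ B i (suc (suc (suc (suc (suc zero))))) ∷ []
  x = row zero
  y = row (suc zero)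
  z = row (suc (suc zero))
  A : Fin 6 → Fin 6 → Bool
  A = adjᵁ {6} (path+triangle x y z)
  upper-B : ∀ {a b c d e f} → a ≡ true → b ≡ false → c ≡ true → d ≡ true → e ≡ true → f ≡ true →
            _≡_ {A = Upper 6} (a ∷ b ∷ x , c ∷ y , z , d ∷ e ∷ [] , f ∷ [] , [] , tt) (path+triangle x y z)
  upper-B refl refl refl refl refl refl = refl
  A≡ : ∀ i j → A i j ≡ B i j
  A≡ i j = trans (cong (λ U → adjᵁ {6} U i j) (sym (upper-B u~m u≁v (Adj-sym G v~m) s~q s~r q~r)))
    (adjᵁ-upper B (λ i j → Graph.sym G (w i) (w j)) (λ i → irrefl G (w i)) i j)
  count-A : ∀ i → count (A i) ≡ deg G (w i)
  count-A i = trans (sum-cong-≗ λ j → cong ind (A≡ i j)) (sum-relabel six all (ind ∘ adj G (w i)))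
  onto : ∀ z → ∃[ i ] z ≡ w i
  onto z = Any.index (all z) , lookup-index (all z)
  one-one : ∀ {i j} → i ≢ j → w i ≢ w j
  one-one i≢j e = i≢j (lookup-injective six _ _ e)
  split-A : AllSplit A
  split-A i j i≢j ij with splits (w i) (w j) (one-one i≢j) (trans (sym (A≡ i j)) ij)
  ... | k , sp with onto k
  ...   | k , refl = k , mkSplit (trans (A≡ i k) (Split.um sp)) (trans (A≡ j k) (Split.vm sp))
          λ a (a₁ , a₂ , a₃) b (b₁ , b₂ , b₃) a≢b → trans (A≡ a b)
            (Split.rest sp (w a) (one-one a₁ , one-one a₂ , one-one a₃) (w b) (one-one b₁ , one-one b₂ , one-one b₃) (one-one a≢b))
  wheel : ∃ (WheelMatrix A) → ∃[ h ] Wheel G h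
  wheel (h , hub) = w h , λ {v} v≢h → spoke (onto v) v≢h
    where
    spoke : ∀ {v} → ∃[ i ] v ≡ w i → v ≢ w h → Adj G (w h) v × deg G v ≡ 3
    spoke (i , refl) v≢h with e , d ← hub i (λ i≡h → v≢h (cong w i≡h)) = trans (sym (A≡ h i)) e , trans (sym (count-A i)) d

universal⇒deg : ∀ {n} (G : Graph n) {h} → (∀ {v} → v ≢ h → Adj G h v) → n ≤ deg G h + 1
universal⇒deg {n} G {h} univ = begin
  n                                      ≡⟨ sym (trans (sum-const n 1) (*-identityʳ n)) ⟩
  sum {n} (λ _ → 1)                      ≤⟨ sum-mono pt ⟩
  sum (λ i → ind (adj G h i) + δ h i)    ≡⟨ ∑-distrib-+ (ind ∘ adj G h) (δ h) ⟩
  deg G h + sum (δ h)                    ≡⟨ cong (deg G h +_) (trans (sum-cong-≗ λ i → sym (*-identityʳ (δ h i))) (sum-δ h (λ _ → 1))) ⟩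
  deg G h + 1                            ∎
  where
  open ≤-Reasoning
  pt : ∀ i → 1 ≤ ind (adj G h i) + δ h i
  pt i with i ≟ h
  ... | yes refl = m≤n+m 1 (ind (adj G h h))
  ... | no i≢h rewrite univ i≢h = s≤s z≤n

six-vertices : ∀ {G : Graph 6} → CoreSaturated G → degSum G ≤ 20 → ∃[ h ] Wheel G h
six-vertices {G} sat small with any? (λ u → any? λ v → ¬? (u ≟ v) ×-dec (adj G u v Bool.≟ false))
... | yes (u , v , u≢v , u≁v) = path-triangle⇒wheel {G} (λ i j i≢j ij → path-triangle⇒split {G} (named i≢j ij)) small u≁v (named u≢v u≁v)
  where
  named : ∀ {i j} → i ≢ j → adj G i j ≡ false → PathTriangle G i j
  named i≢j ij = path-triangle {G} i≢j ij (CoreSaturated.link sat i≢j ij)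
-- In `K₆` every degree is 5, and 30 exceeds 20.
... | no complete = ⊥-elim (<⇒≱ (+-monoʳ-≤ 21 (z≤n {9})) (≤-trans (subst (_≤ degSum G) (sum-const 6 5) (sum-mono deg≥5)) small))
  where
  deg≥5 : ∀ h → 5 ≤ deg G h
  deg≥5 h = +-cancelʳ-≤ 1 5 (deg G h) (universal⇒deg G {h} λ {v} v≢h →
    decidable-stable (adj G h v Bool.≟ true) λ ¬a → complete (h , v , (λ e → v≢h (sym e)) , ≢true⇒≡false ¬a))

sparse-unjoined : (G : Graph 6) → degSum G ≤ 10 → ¬ AllJoin (adj G)
sparse-unjoined G small joins = joins-search U
  (*-cancelˡ-≤ 2 (subst (_≤ 10) (trans (sym (sum-cong-≗ λ i → sum-cong-≗ λ j → cong ind (A≡ i j))) (matrixSum-edges U)) small))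
  λ u v u≢v u≁v → case joins u v u≢v (trans (sym (A≡ u v)) u≁v) of
    λ { (m , um , m≢v , k , vk , k≢u , mk , b , b∉ , c , bc , c∉) →
      m , trans (A≡ u m) um , m≢v , k , trans (A≡ v k) vk , k≢u ,
      map-⊎ id (trans (A≡ m k)) mk , b , b∉ , c , trans (A≡ b c) bc , c∉ }
  where
  U : Upper 6
  U = upper (adj G)
  A≡ : ∀ i j → adjᵁ U i j ≡ adj G i j
  A≡ = adjᵁ-upper (adj G) (Graph.sym G) (irrefl G)

-- Seven vertices: leaves and subdivided edges

Tri : ∀ {n} → Graph n → Fin n → Fin n → Fin n → Set
Tri G w x y = Nbrs G w x y × Adj G x y

Tri-swap : ∀ {n} {G : Graph n} {w x y} → Tri G w x y → Tri G w y x
Tri-swap {G = G} ((wx , wy , x≢y , only) , xy) =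
  (wy , wx , (λ e → x≢y (sym e)) , λ a → [ inj₂ , inj₁ ]′ (only a)) , Adj-sym G xy

triangle⇒core : ∀ {n} {G : Graph n} {x y z} → Adj G x y → Adj G y z → Adj G x z → Core G (_∈ (x ∷ y ∷ z ∷ []))
triangle⇒core {G = G} {x} {y} {z} xy yz xz = (x , here refl) , λ
  { (here refl)                 → y , z , Adj-≢ G yz , (there (here refl) , xy) , (there (there (here refl)) , xz)
  ; (there (here refl))         → x , z , Adj-≢ G xz , (here refl , Adj-sym G xy) , (there (there (here refl)) , yz)
  ; (there (there (here refl))) → x , y , Adj-≢ G xy , (here refl , Adj-sym G xz) , (there (here refl) , Adj-sym G yz) }

four-cycle⇒core : ∀ {n} {G : Graph n} {x y z t} → Adj G x y → Adj G y z → Adj G z t → Adj G t x → x ≢ z → y ≢ t →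
                  Core G (_∈ (x ∷ y ∷ z ∷ t ∷ []))
four-cycle⇒core {G = G} {x} {y} {z} {t} xy yz zt tx x≢z y≢t = (x , here refl) , λ
  { (here refl)                         → y , t , y≢t , (there (here refl) , xy) , (there (there (there (here refl))) , Adj-sym G tx)
  ; (there (here refl))                 → x , z , x≢z , (here refl , Adj-sym G xy) , (there (there (here refl)) , yz)
  ; (there (there (here refl)))         → y , t , y≢t , (there (here refl) , Adj-sym G yz) , (there (there (there (here refl))) , zt)
  ; (there (there (there (here refl)))) → x , z , x≢z , (here refl , tx) , (there (there (here refl)) , Adj-sym G zt) }

-- The rim of the wheel on six vertices is a 5-cycle, so a core avoiding the hub is the whole rim.
wheel-core : ∀ {G : Graph 6} {h} → Wheel G h → ∀ {P} → Core G P → ¬ P h → ∀ {v} → v ≢ h → ¬ P v → ⊥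
wheel-core {G} {h} wheel {P} ((s , Ps) , two) ¬Ph {v} v≢h ¬Pv
  with p , q , p≢q , (Pp , s~p) , (Pq , s~q) ← two Ps
  with j , v~j , j∉ ← pick (adj G v) (h ∷ []) (≤-trans (s≤s (s≤s z≤n)) (≤-reflexive (sym (proj₂ (wheel v≢h)))))
  with k , v~k , k∉ ← pick (adj G v) (h ∷ j ∷ []) (≤-reflexive (sym (proj₂ (wheel v≢h)))) =
  1+n≰n (length≤n seven)
  where
  ≢P : ∀ {a b} → ¬ P a → P b → a ≢ b
  ≢P ¬Pa Pb refl = ¬Pa Pb
  -- Absence from the core spreads along the rim: `j` has degree 3 and already has the neighbours
  -- `h` and `v` outside. So `h`, `v` and both rim neighbours of `v` are outside, too many next to
  -- the three core vertices `s`, `p`, `q`.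
  rim : ∀ {j} → Adj G v j → j ≢ h → ¬ P j
  rim {j} v~j j≢h Pj with a , b , a≢b , (Pa , ja) , (Pb , jb) ← two Pj =
    1+n≰n (subst (4 ≤_) (proj₂ (wheel j≢h)) (length≤count
      (((λ e → v≢h (sym e)) ∷ ≢P ¬Ph Pa ∷ ≢P ¬Ph Pb ∷ []) ∷ (≢P ¬Pv Pa ∷ ≢P ¬Pv Pb ∷ []) ∷ (a≢b ∷ []) ∷ [] ∷ [])
      (Adj-sym G (proj₁ (wheel j≢h)) ∷ Adj-sym G v~j ∷ ja ∷ jb ∷ [])))
  ¬Pj = rim v~j (j∉ ∘ here)
  ¬Pk = rim v~k (k∉ ∘ here)
  seven : Unique (h ∷ v ∷ j ∷ k ∷ s ∷ p ∷ q ∷ [])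
  seven = ((λ e → v≢h (sym e)) ∷ (λ e → j∉ (here (sym e))) ∷ (λ e → k∉ (here (sym e))) ∷ ≢P ¬Ph Ps ∷ ≢P ¬Ph Pp ∷ ≢P ¬Ph Pq ∷ [])
    ∷ (Adj-≢ G v~j ∷ Adj-≢ G v~k ∷ ≢P ¬Pv Ps ∷ ≢P ¬Pv Pp ∷ ≢P ¬Pv Pq ∷ [])
    ∷ ((λ e → k∉ (there (here (sym e)))) ∷ ≢P ¬Pj Ps ∷ ≢P ¬Pj Pp ∷ ≢P ¬Pj Pq ∷ [])
    ∷ (≢P ¬Pk Ps ∷ ≢P ¬Pk Pp ∷ ≢P ¬Pk Pq ∷ [])
    ∷ (Adj-≢ G s~p ∷ Adj-≢ G s~q ∷ []) ∷ (p≢q ∷ []) ∷ [] ∷ []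

-- Deleting the leaf leaves the wheel. The core opposite a path from `l` to `j` misses `j` and the
-- neighbour `i` of `l`; with `j` chosen so that the hub is one of these two, a rim vertex is missed
-- as well.
seven-leaf : ∀ {G : Graph 7} {l} → CoreSaturated G → deg G l ≡ 1 → ¬ Two (Adj G l) → degSum G ≤ 22 → ⊥
seven-leaf {G} {l} sat d1 ¬2 small = case six-vertices (remove-leaf sat ¬2) small′ of λ { (h , wheel) → go h wheel }
  where
  open CoreSaturated sat
  small′ : degSum (del G l) ≤ 20
  small′ = +-cancelʳ-≤ 2 _ 20 (subst (_≤ 22) (trans (degSum-del G l) (cong (λ k → degSum (del G l) + 2 * k) d1)) small)
  go : ∀ h → Wheel (del G l) h → ⊥
  go h wheel with x , l~x , _ ← pick (adj G l) [] (≤-reflexive (sym d1)) | punchIn-view l x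
  ... | inj₁ refl       = Adj-≢ G l~x refl
  ... | inj₂ (i , refl) = contra
    where
    only : ∀ {j} → Adj G l (punchIn l j) → j ≡ i
    only {j} a with j ≟ i
    ... | yes e = e
    ... | no ne = ⊥-elim (¬2 (punchIn l j , punchIn l i , ne ∘ punchIn-injective l j i , a , l~x))
    -- The core opposite a path from l avoids both the neighbour of l and the other end.
    avoid : ∀ {j} → j ≢ i → (∀ {P} → Core (del G l) P → ¬ P i → ¬ P j → ⊥) → ⊥
    avoid {j} j≢i k = k (core-del⁺ {G = G} l {λ z → other z ≡ true} (disj u∈) core) (disj i∈) (disj v∈)
      where
      open Linked (link {l} {punchIn l j} (punchInᵢ≢i l j ∘ sym) (≢true⇒≡false (j≢i ∘ only)))
      i∈ : side (punchIn l i) ≡ true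
      i∈ with p , Sp , a ← u-nbr | punchIn-view l p
      ... | inj₁ refl       = ⊥-elim (Adj-≢ G a refl)
      ... | inj₂ (j , refl) = subst (λ j → side (punchIn l j) ≡ true) (only a) Sp
    contra : ⊥
    contra with h ≟ i
    ... | no h≢i = avoid h≢i λ C ¬i ¬h → wheel-core {del G l} wheel C ¬h (λ e → h≢i (sym e)) ¬i
    ... | yes refl with j , j∉ ← pickFin {6} (h ∷ []) (s≤s (s≤s z≤n)) =
      avoid (j∉ ∘ here) λ C ¬h ¬j → wheel-core {del G l} wheel C ¬h (j∉ ∘ here) ¬j

-- Suppressing `w` leaves the wheel. If its hub is `x` or `y`, the core for the non-edge `xy` misses
-- the hub and a rim vertex. Otherwise the non-edge from `w` to the hub does: its side contains `x`
-- or `y`.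
seven-path : ∀ {G : Graph 7} {w x y} → CoreSaturated G → deg G w ≡ 2 →
             Nbrs G w (punchIn w x) (punchIn w y) → adj (del G w) x y ≡ false → degSum G ≤ 22 → ⊥
seven-path {G} {w} {x} {y} sat d2 N@(_ , _ , ιx≢ιy , only) x≁y small =
  case six-vertices suppress (+-cancelʳ-≤ 2 _ 20 (≤-trans (degSum-suppressed d2) small)) of λ { (h , wheel) → go h wheel }
  where
  open CoreSaturated sat
  open Suppress sat N x≁y
  x≢y : x ≢ y
  x≢y e = ιx≢ιy (cong (punchIn w) e)
  xy-linked : Linked G (punchIn w x) (punchIn w y)
  xy-linked = link ιx≢ιy x≁y
  open Linked xy-linked using () renaming (other to other₀; core to core₀; disj to disj₀; u∈ to x∈; v∈ to y∈)
  ¬x = disj₀ x∈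
  ¬y = disj₀ y∈
  pulled = core-pull {λ z → other₀ z ≡ true} (λ o → ¬x (proj₁ (both-nbrs {G = G} N (proj₂ core₀ o)))) core₀
  go : ∀ h → Wheel suppressed h → ⊥
  go h wheel = at (h ≟ x) (h ≟ y)
    where
    at : Dec (h ≡ x) → Dec (h ≡ y) → ⊥
    at (yes h≡x) _ = wheel-core {suppressed} wheel pulled (λ o → ¬x (subst (λ i → other₀ (punchIn w i) ≡ true) h≡x o))
      (λ y≡h → x≢y (sym (trans y≡h h≡x))) ¬y
    at (no _) (yes h≡y) = wheel-core {suppressed} wheel pulled (λ o → ¬y (subst (λ i → other₀ (punchIn w i) ≡ true) h≡y o))
      (λ x≡h → x≢y (trans x≡h h≡y)) ¬x
    at (no h≢x) (no h≢y) = rim u-nbr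
      where
      w≁h : ¬ Adj G w (punchIn w h)
      w≁h a = [ h≢x ∘ punchIn-injective w h x , h≢y ∘ punchIn-injective w h y ]′ (only a)
      open Linked (link {w} {punchIn w h} (punchInᵢ≢i w h ∘ sym) (≢true⇒≡false w≁h))
      C = core-pull {λ z → other z ≡ true} (disj u∈) core
      rim : ∃[ p ] (side p ≡ true × Adj G w p) → ⊥
      rim (p , Sp , a) with only a
      ... | inj₁ refl = wheel-core {suppressed} wheel C (disj v∈) (λ e → h≢x (sym e)) (disj Sp)
      ... | inj₂ refl = wheel-core {suppressed} wheel C (disj v∈) (λ e → h≢y (sym e)) (disj Sp)

-- Graphs with a vertex meeting all cycles

-- Ranges over cycles instead of arbitrary core predicates, which keeps it in `Set`.
CycleAvoiding : ∀ {n} → Graph n → Fin n → Set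
CycleAvoiding G h = Σ[ C ∈ Cycle G ] (Core G (_∈ verts C) × h ∉ verts C)

core-avoiding : ∀ {n} {G : Graph n} {P : Fin n → Set} {h} → Core G P → ¬ P h → CycleAvoiding G h
core-avoiding {G = G} CP ¬Ph with C , aP ← core⇒cycle {G = G} CP = C , cycle⇒core C , λ h∈ → ¬Ph (All.lookup aP h∈)

-- `joins` stands in for connectedness: it is what saturation supplies, and it survives the deletion
-- of a leaf.
record Tree {n} (T : Graph n) : Set₁ where
  field
    acyclic : ∀ {P} → Core T P → ⊥
    joins   : ∀ {u v} → u ≢ v → adj T u v ≡ false → Joined T u v

joins⇒deg : ∀ {n} (G : Graph n) → 2 ≤ n → (∀ {u v} → u ≢ v → adj G u v ≡ false → Joined G u v) → ∀ v → 1 ≤ deg G v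
joins⇒deg G 2≤n joins v with z , z∉ ← pickFin (v ∷ []) 2≤n | adj G v z in eq
... | true  = length≤count {S = adj G v} ([] ∷ []) (eq ∷ [])
... | false = length≤count {S = adj G v} ([] ∷ []) (proj₂ (proj₂ (Joined.u-nbr (joins (λ e → z∉ (here (sym e))) eq))) ∷ [])

tree-step : ∀ {k} {T : Graph (suc (suc k))} → Tree T → (∀ {T′ : Graph (suc k)} → Tree T′ → 2 * suc k ≤ degSum T′ + 2) →
            2 * suc (suc k) ≤ degSum T + 2
tree-step {k} {T} tree IH with low-degree T {λ _ → true} {zero} refl (λ C _ → Tree.acyclic tree C)
... | v , _ , d≤1 = begin
  2 * suc (suc k)                       ≡⟨ lemma k ⟩
  2 * suc k + 2                         ≤⟨ +-monoˡ-≤ 2 (IH {del T v} pruned) ⟩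
  degSum (del T v) + 2 + 2              ≤⟨ +-monoˡ-≤ 2 (+-monoʳ-≤ (degSum (del T v)) (*-monoʳ-≤ 2 1≤d)) ⟩
  degSum (del T v) + 2 * deg T v + 2    ≡⟨ cong (_+ 2) (sym (degSum-del T v)) ⟩
  degSum T + 2                          ∎
  where
  open ≤-Reasoning
  open Tree tree
  lemma : ∀ k → 2 * suc (suc k) ≡ 2 * suc k + 2
  lemma = solve-∀
  ¬2 : ¬ Two (Adj T v)
  ¬2 t = 1+n≰n (≤-trans (Two-count {S = adj T v} t) d≤1)
  pruned : Tree (del T v)
  pruned = record
    { acyclic = λ C → acyclic (core-del⁻ {G = T} v C)
    ; joins = λ {a} {b} a≢b a≁b → let J = joins (a≢b ∘ punchIn-injective v a b) a≁b in
        joined-del⁺ v J (leaf∉joined {G = T} ¬2 J) }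
  1≤d : 1 ≤ deg T v
  1≤d = joins⇒deg T (s≤s (s≤s z≤n)) joins v

-- At least `n - 1` edges, by pruning leaves; `joins` rules out isolated vertices as long as two
-- vertices remain.
tree-bound : ∀ n {T : Graph n} → Tree T → 2 * n ≤ degSum T + 2
tree-bound zero              tree = z≤n
tree-bound (suc zero)    {T} tree = m≤n+m 2 (degSum T)
tree-bound (suc (suc k)) {T} tree = tree-step {T = T} tree (λ {T′} → tree-bound (suc k) {T′})

-- If deleting h leaves a forest, saturation makes h adjacent to all vertices and G - h a tree.
module Hub {m} {G : Graph (suc m)} (sat : CoreSaturated G) {h : Fin (suc m)}
           (hub : ¬ CycleAvoiding G h) where

  open CoreSaturated sat

  private
    T = del G h

    through : ∀ {P} → Core G P → ¬ ¬ P h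
    through C ¬Ph = hub (core-avoiding {G = G} C ¬Ph)

    -- A non-edge at `h` would have `h` on its side and thus a core avoiding `h` opposite.
    universal : ∀ {v} → v ≢ h → Adj G h v
    universal {v} v≢h with adj G h v in eq
    ... | true  = refl
    ... | false = ⊥-elim (through core (disj u∈))
      where open Linked (link (λ e → v≢h (sym e)) eq)

    deg-hub : m ≤ deg G h
    deg-hub = +-cancelʳ-≤ 1 m (deg G h) (subst (_≤ deg G h + 1) (+-comm 1 m) (universal⇒deg G {h} universal))

    ι≢h : ∀ {i} → punchIn h i ≢ h
    ι≢h {i} = punchInᵢ≢i h i

    link-T : ∀ {u v} → u ≢ v → adj T u v ≡ false → Linked G (punchIn h u) (punchIn h v)
    link-T {u} {v} u≢v u≁v = link (u≢v ∘ punchIn-injective h u v) u≁v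

    h∉side : ∀ {u v} (L : Linked G u v) → ¬ (Linked.side L h ≡ true)
    h∉side L Sh = through (Linked.core L) (Linked.disj L Sh)

    tree : 2 * m ≤ degSum T + 2
    tree = tree-bound m {T} record
      { acyclic = λ C → through (core-del⁻ {G = G} h C) λ { (i , e , _) → ι≢h e }
      ; joins = λ u≢v u≁v → let L = link-T u≢v u≁v in joined-del⁺ h (Linked.joined L) (h∉side L) }

  degSum-T : degSum T + 2 * m ≤ degSum G
  degSum-T = subst (degSum T + 2 * m ≤_) (sym (degSum-del G h)) (+-monoʳ-≤ (degSum T) (*-monoʳ-≤ 2 deg-hub))

  -- The opposite core contains `h`; a neighbour `b` of `h` in it and a further neighbour `c` of `b`
  -- form the edge off the path. With two of the six vertices used up, the side lies within `u`,
  -- `v`, a neighbour of `u` and a neighbour of `v`, so the path has at most three edges.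
  joins : m ≡ 6 → AllJoin (adj T)
  joins m≡6 u v u≢v u≁v = goal (nbr-del⁺ {G = G} h (h∉side L) u-nbr) (nbr-del⁺ {G = G} h (h∉side L) v-nbr)
    where
    L = link-T u≢v u≁v
    open Linked L
    S : Fin m → Set
    S i = side (punchIn h i) ≡ true
    Oh : other h ≡ true
    Oh = decidable-stable (other h Bool.≟ true) (through core)
    edge : ∃[ b ] ∃[ c ] (other (punchIn h b) ≡ true × other (punchIn h c) ≡ true × Adj T b c)
    edge with b , _ , _ , (Ob , h~b) , _ ← proj₂ core Oh with punchIn-view h b
    ... | inj₁ refl = ⊥-elim (Adj-≢ G h~b refl)
    ... | inj₂ (b′ , refl) with c , c≢h , Oc , b~c ← Two-avoid h (proj₂ core Ob) | punchIn-view h c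
    ...   | inj₁ refl = contradiction refl c≢h
    ...   | inj₂ (c′ , refl) = b′ , c′ , Ob , Oc , b~c
    out : ∀ {b a k} → other (punchIn h b) ≡ true → S a → S k → b ∉ (u ∷ v ∷ a ∷ k ∷ [])
    out Ob Sa Sk (here refl) = disj u∈ Ob
    out Ob Sa Sk (there (here refl)) = disj v∈ Ob
    out Ob Sa Sk (there (there (here refl))) = disj Sa Ob
    out Ob Sa Sk (there (there (there (here refl)))) = disj Sk Ob
    goal : ∃[ a ] (S a × Adj T u a) → ∃[ k ] (S k × Adj T v k) → Joins (adj T) u v
    goal (a , Sa , u~a) (k , Sk , v~k) with b , c , Ob , Oc , b~c ← edge | adj T v a in eq
    ... | true = a , u~a , (λ e → Adj-≢ T eq (sym e)) , a , eq , (λ e → Adj-≢ T u~a (sym e)) , inj₁ refl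
               , b , out Ob Sa Sa , c , b~c , out Oc Sa Sa
    ... | false = a , u~a , a≢v , k , v~k , k≢u , inj₂ a~k , b , out Ob Sa Sk , c , b~c , out Oc Sa Sk
      where
      v≁a : ¬ Adj T v a
      v≁a x with () ← trans (sym x) eq
      a≢v : a ≢ v
      a≢v refl with () ← trans (sym u~a) u≁v
      k≢u : k ≢ u
      k≢u refl with () ← trans (sym (Adj-sym T v~k)) u≁v
      a≢k : a ≢ k
      a≢k refl = v≁a v~k
      O≢ : ∀ {i j} → S i → other (punchIn h j) ≡ true → i ≢ j
      O≢ Si Oj refl = disj Si Oj
      six : Unique (u ∷ v ∷ a ∷ k ∷ b ∷ c ∷ [])
      six = (u≢v ∷ Adj-≢ T u~a ∷ (λ e → k≢u (sym e)) ∷ O≢ u∈ Ob ∷ O≢ u∈ Oc ∷ [])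
        ∷ ((λ e → a≢v (sym e)) ∷ Adj-≢ T v~k ∷ O≢ v∈ Ob ∷ O≢ v∈ Oc ∷ [])
        ∷ (a≢k ∷ O≢ Sa Ob ∷ O≢ Sa Oc ∷ []) ∷ (O≢ Sk Ob ∷ O≢ Sk Oc ∷ []) ∷ (Adj-≢ T b~c ∷ []) ∷ [] ∷ []
      a~k : Adj T a k
      a~k with p , p≢u , Sp , a~p ← Two-avoid u (two-del⁺ {G = G} h (h∉side L)
                 (inner Sa ((λ e → Adj-≢ T u~a (sym e)) ∘ punchIn-injective h a u) (a≢v ∘ punchIn-injective h a v)))
             | cover six (≤-reflexive m≡6) p
      ... | here e = contradiction e p≢u
      ... | there (here refl) = ⊥-elim (v≁a (Adj-sym T a~p))
      ... | there (there (here refl)) = ⊥-elim (Adj-≢ T a~p refl)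
      ... | there (there (there (here refl))) = a~p
      ... | there (there (there (there (here refl)))) = ⊥-elim (disj Sp Ob)
      ... | there (there (there (there (there (here refl))))) = ⊥-elim (disj Sp Oc)

  hub-degSum : 2 * m + 2 * m ≤ degSum G + 2
  hub-degSum = begin
    2 * m + 2 * m            ≤⟨ +-monoˡ-≤ (2 * m) tree ⟩
    degSum T + 2 + 2 * m     ≡⟨ lemma (degSum T) (2 * m) ⟩
    degSum T + 2 * m + 2     ≤⟨ +-monoˡ-≤ 2 degSum-T ⟩
    degSum G + 2             ∎
    where
    open ≤-Reasoning
    lemma : ∀ a b → a + 2 + b ≡ a + b + 2
    lemma = solve-∀

-- With `n = suc m`, the hub and the tree force a degree sum of at least `4m - 2`. This exceeds
-- `2(m + 1) + 8` for `m ≥ 7` and equals it for `m = 6`, which is why that case needs the search.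
no-hub : ∀ {n} {G : Graph n} → CoreSaturated G → 7 ≤ n → degSum G ≤ 2 * n + 8 → ∀ h → ¬ ¬ CycleAvoiding G h
no-hub {suc m} {G} sat (s≤s 6≤m) small h hub with m Nat.≟ 6
... | yes m≡6 = unjoined m≡6 (del G h) sparse (Hub.joins {G = G} sat hub m≡6)
  where
  unjoined : ∀ {m} → m ≡ 6 → (T : Graph m) → degSum T ≤ 10 → ¬ AllJoin (adj T)
  unjoined refl = sparse-unjoined
  lemma : ∀ m → 2 * suc m + 8 ≡ 10 + 2 * m
  lemma = solve-∀
  sparse : degSum (del G h) ≤ 10
  sparse = +-cancelʳ-≤ (2 * m) _ 10 (≤-trans (Hub.degSum-T {G = G} sat hub) (subst (degSum G ≤_) (lemma m) small))
... | no m≢6 = 1+n≰n (begin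
  suc (2 * m + 12)     ≤⟨ n≤1+n _ ⟩
  2 + (2 * m + 12)     ≡⟨ lemma₁ m ⟩
  2 * m + 2 * 7        ≤⟨ +-monoʳ-≤ (2 * m) (*-monoʳ-≤ 2 (≤∧≢⇒< 6≤m (λ e → m≢6 (sym e)))) ⟩
  2 * m + 2 * m        ≤⟨ Hub.hub-degSum {G = G} sat hub ⟩
  degSum G + 2         ≤⟨ +-monoˡ-≤ 2 small ⟩
  2 * suc m + 8 + 2    ≡⟨ lemma₂ m ⟩
  2 * m + 12           ∎)
  where
  open ≤-Reasoning
  lemma₁ : ∀ m → 2 + (2 * m + 12) ≡ 2 * m + 2 * 7
  lemma₁ = solve-∀
  lemma₂ : ∀ m → 2 * suc m + 8 + 2 ≡ 2 * m + 12
  lemma₂ = solve-∀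

-- Graphs in which every vertex of degree 2 lies in a triangle

excess : ∀ {n} (G : Graph n) {c L} → (∀ v → c ≤ deg G v) → Unique L → n * c + sumᴸ (λ v → deg G v ∸ c) L ≤ degSum G
excess {n} G {c} {L} low u = begin
  n * c + sumᴸ (λ v → deg G v ∸ c) L          ≤⟨ +-monoʳ-≤ (n * c) (sumᴸ≤sum u (λ v → deg G v ∸ c)) ⟩
  n * c + sum (λ v → deg G v ∸ c)             ≡⟨ cong (_+ sum (λ v → deg G v ∸ c)) (sym (sum-const n c)) ⟩
  sum {n} (λ _ → c) + sum (λ v → deg G v ∸ c) ≡⟨ sym (∑-distrib-+ {n} (λ _ → c) (λ v → deg G v ∸ c)) ⟩
  sum (λ v → c + (deg G v ∸ c))               ≡⟨ sum-cong-≗ (λ v → m+[n∸m]≡n (low v)) ⟩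
  degSum G                                    ∎
  where open ≤-Reasoning

module Reduced {n} {G : Graph n} (sat : CoreSaturated G) (7≤n : 7 ≤ n) (small : degSum G ≤ 2 * n + 8)
               (deg≥2 : ∀ v → 2 ≤ deg G v)
               (low : ∀ {v} → deg G v ≡ 2 → ∃₂ λ x y → Tri G v x y) where

  open CoreSaturated sat

  private
    infix 4 _~_
    _~_ : Fin n → Fin n → Set
    _~_ = Adj G

    flip~ : ∀ {u v} → u ~ v → v ~ u
    flip~ = Adj-sym G

    ≢~ : ∀ {u v} → u ~ v → u ≢ v
    ≢~ = Adj-≢ G

    ≢≁ : ∀ {u v} → ¬ (u ~ v) → adj G u v ≡ false
    ≢≁ = ≢true⇒≡false

    flip≢ : ∀ {u v : Fin n} → u ≢ v → v ≢ u
    flip≢ u≢v e = u≢v (sym e)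

    split : ∀ {P : Fin n → Set} {u v} → ¬ P u → P v → u ≢ v
    split ¬Pu Pv refl = ¬Pu Pv

    deg≢2 : ∀ {v} → deg G v ≢ 2 → 3 ≤ deg G v
    deg≢2 {v} h = ≤∧≢⇒< (deg≥2 v) λ e → h (sym e)

    heavy : ∀ {L} → Unique L → 9 ≤ sumᴸ (λ v → deg G v ∸ 2) L → ⊥
    heavy {L} u h = 1+n≰n {8} (+-cancelˡ-≤ (2 * n) 9 8 (≤-trans (+-monoʳ-≤ (2 * n) h)
      (≤-trans (≤-trans (≤-reflexive (cong (_+ sumᴸ (λ v → deg G v ∸ 2) L) (*-comm 2 n))) (excess G deg≥2 u)) small)))

    wt : ∀ {v} k → 2 + k ≤ deg G v → k ≤ deg G v ∸ 2
    wt k = ∸-monoˡ-≤ 2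

    avoids : ∀ {P Q : Fin n → Set} → Core G P → Core G Q → (∀ {v} → P v → ¬ Q v) → ⊥
    avoids CP CQ d = none (_ , _ , CP , CQ , d)

    deg2-closed : ∀ {P v x} → Core G P → deg G v ≡ 2 → v ~ x → ¬ P x → ¬ P v
    deg2-closed C d v~x ¬Px Pv with p , q , p≢q , (Pp , v~p) , (Pq , v~q) ← proj₂ C Pv =
      1+n≰n (subst (3 ≤_) d (length≤count ((split ¬Px Pp ∷ split ¬Px Pq ∷ []) ∷ (p≢q ∷ []) ∷ [] ∷ []) (v~x ∷ v~p ∷ v~q ∷ [])))

    tri-deg : ∀ {w x y} → Tri G w x y → deg G w ≡ 2
    tri-deg {w} {x} {y} ((_ , _ , _ , only) , _) =
      ≤-antisym (count≤length (x ∷ y ∷ []) λ z w~z → [ here , there ∘ here ]′ (only w~z)) (deg≥2 w)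

    tri-core : ∀ {w x y} → Tri G w x y → Core G (_∈ (w ∷ x ∷ y ∷ []))
    tri-core ((wx , wy , _ , _) , xy) = triangle⇒core {G = G} wx xy wy

    -- A core missing both `x` and `y` would also miss `w`, and so be disjoint from the triangle.
    tri-hit : ∀ {w x y P} → Tri G w x y → Core G P → ¬ P x → ¬ ¬ P y
    tri-hit T@((wx , _) , _) C ¬Px ¬Py = avoids C (tri-core T) λ
      { Pv (here refl) → deg2-closed C (tri-deg T) wx ¬Px Pv
      ; Pv (there (here refl)) → ¬Px Pv
      ; Pv (there (there (here refl))) → ¬Py Pv }

    -- The neighbours `w` and `x` lie outside the core, and `y` has two more inside.
    tri-deg4 : ∀ {w x y P} → Tri G w x y → Core G P → ¬ P x → P y → 4 ≤ deg G y
    tri-deg4 T@((wx , wy , _ , _) , xy) C ¬Px Py with p , q , p≢q , (Pp , y~p) , (Pq , y~q) ← proj₂ C Py =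
      length≤count ((≢~ wx ∷ split ¬Pw Pp ∷ split ¬Pw Pq ∷ []) ∷ (split ¬Px Pp ∷ split ¬Px Pq ∷ []) ∷ (p≢q ∷ []) ∷ [] ∷ [])
                   (flip~ wy ∷ flip~ xy ∷ y~p ∷ y~q ∷ [])
      where ¬Pw = deg2-closed C (tri-deg T) wx ¬Px

    tri-orient : ∀ {w x y z} → Tri G w x y → w ~ z → ∃[ t ] Tri G w z t
    tri-orient {x = x} {y} T@((_ , _ , _ , only) , _) w~z with only w~z
    ... | inj₁ refl = y , T
    ... | inj₂ refl = x , Tri-swap {G = G} T

    -- Every core missing x contains both y and u, so the core opposite a path from w to u
    -- contains x; this forces degrees 6, 4, 4 at x, y, u, and one more unit of excess comes
    -- from a neighbour p of x in that core or from the third vertex of the triangle at p.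
    one-shared : ∀ {w x y w′ u} → Tri G w x y → Tri G w′ x u → y ≢ u → w′ ≢ y →
                 ¬ ¬ CycleAvoiding G x → ⊥
    one-shared {w} {x} {y} {w′} {u} T@((wx , wy , x≢y , only) , xy) T′@((w′x , w′u , x≢u , only′) , xu) y≢u w′≢y avoid =
      avoid λ { (C₀ , C , x∉C) → tri-hit T C x∉C λ y∈C → tri-hit T′ C x∉C λ u∈C → main C x∉C y∈C u∈C }
      where
      w≢w′ : w ≢ w′
      w≢w′ refl = [ (λ e → x≢u (sym e)) , (λ e → y≢u (sym e)) ]′ (only w′u)
      w≢u : w ≢ u
      w≢u refl = [ (λ e → ≢~ w′x e) , w′≢y ]′ (only (flip~ w′u))
      w≁u : ¬ (w ~ u)
      w≁u a = [ (λ e → x≢u (sym e)) , (λ e → y≢u (sym e)) ]′ (only a)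
      open Linked (link w≢u (≢≁ w≁u))
      main : ∀ {C} → Core G C → ¬ C x → C y → C u → ⊥
      main {C} CC ¬Cx Cy Cu with x-other
        where
        x-other : other x ≡ true
        x-other = decidable-stable (other x Bool.≟ true) λ ¬Ox → tri-hit T′ core ¬Ox (disj v∈)
      ... | Ox with p , q , p≢q , (Op , x~p) , (Oq , x~q) ← proj₂ core Ox = finish
        where
        Sy : side y ≡ true
        Sy with p , Sp , w~p ← u-nbr with only w~p
        ... | inj₁ refl = ⊥-elim (disj Sp Ox)
        ... | inj₂ refl = Sp
        ¬Ow  = disj u∈
        ¬Ou  = disj v∈
        ¬Oy  = disj Sy
        ¬Ow′ = deg2-closed core (tri-deg T′) w′u ¬Ou
        O≢ : ∀ {a b} → ¬ (other a ≡ true) → other b ≡ true → a ≢ b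
        O≢ = split {P = λ z → other z ≡ true}
        deg-x : 6 ≤ deg G x
        deg-x = length≤count
          ( (≢~ wy ∷ w≢w′ ∷ w≢u ∷ O≢ ¬Ow Op ∷ O≢ ¬Ow Oq ∷ [])
          ∷ (flip≢ w′≢y ∷ y≢u ∷ O≢ ¬Oy Op ∷ O≢ ¬Oy Oq ∷ [])
          ∷ (≢~ w′u ∷ O≢ ¬Ow′ Op ∷ O≢ ¬Ow′ Oq ∷ [])
          ∷ (O≢ ¬Ou Op ∷ O≢ ¬Ou Oq ∷ []) ∷ (p≢q ∷ []) ∷ [] ∷ [])
          (flip~ wx ∷ xy ∷ flip~ w′x ∷ xu ∷ x~p ∷ x~q ∷ [])
        extra : ∀ {v} → other v ≡ true → x ~ v → 3 ≤ deg G v → ⊥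
        extra Ov x~v d = heavy ((x≢y ∷ x≢u ∷ ≢~ x~v ∷ []) ∷ (y≢u ∷ O≢ ¬Oy Ov ∷ []) ∷ (O≢ ¬Ou Ov ∷ []) ∷ [] ∷ [])
          (+-mono-≤ (wt 4 deg-x) (+-mono-≤ (wt 2 (tri-deg4 T CC ¬Cx Cy)) (+-mono-≤ (wt 2 (tri-deg4 T′ CC ¬Cx Cu)) (+-mono-≤ (wt 1 d) z≤n))))
        finish : ⊥
        finish with deg G p Nat.≟ 2
        ... | no d≢2 = extra Op x~p (deg≢2 d≢2)
        ... | yes d with low d
        ...   | a , b , Tab with tri-orient Tab (flip~ x~p)
        ...     | r , Tr@((p~x , p~r , _ , _) , x~r) with deg G r Nat.≟ 2
        ...       | no d≢2 = extra (proj₂ (both-nbrs {G = G} (proj₁ Tr) (proj₂ core Op))) x~r (deg≢2 d≢2)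
        -- With `p` and `r` both of degree 2 and adjacent to `x`, a core missing `x` misses the
        -- whole triangle `p x r`.
        ...       | yes d′ = avoids CC (tri-core Tr) λ
                      { Cv (here refl) → deg2-closed CC d p~x ¬Cx Cv
                      ; Cv (there (here refl)) → ¬Cx Cv
                      ; Cv (there (there (here refl))) → deg2-closed CC d′ (flip~ x~r) ¬Cx Cv }

    Avoidable : Fin n → Set
    Avoidable x = ¬ ¬ CycleAvoiding G x

    -- A neighbour `p` of degree 2 would carry a triangle through `y` but not through `x`, which
    -- `one-shared` excludes.
    core-nbr : ∀ {w x y P p} → Tri G w x y → w ≢ p → (∀ h → Avoidable h) → Core G P → ¬ P x → P p → y ~ p → 3 ≤ deg G p
    core-nbr {w} {x} {y} {P} {p} T w≢p avoid CP ¬Px Pp y~p with deg G p Nat.≟ 2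
    ... | no d≢2 = deg≢2 d≢2
    ... | yes d with low d
    ...   | a , b , Tab with tri-orient Tab (flip~ y~p)
    ...     | r , Tr = ⊥-elim (one-shared (Tri-swap {G = G} T) Tr
                (split ¬Px (proj₂ (both-nbrs {G = G} (proj₁ Tr) (proj₂ CP Pp)))) (flip≢ (split ¬Px Pp)) (avoid y))

    -- The two triangles cannot be disjoint, and they do not meet in `w`, whose only neighbours are
    -- `x` and `y`. Sharing just one of `x`, `y` is excluded by `one-shared`; sharing both is left
    -- to the last hypothesis.
    low-pair : ∀ {w x y z a b} → Tri G w x y → Tri G z a b → z ∉ (w ∷ x ∷ y ∷ []) → (∀ h → Avoidable h) →
               (Tri G z x y → ⊥) → ⊥
    low-pair {w} {x} {y} {z} {a} {b} T@((_ , _ , _ , only) , _) Tz@((za , zb , _ , _) , _) z∉ avoid twin =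
      avoids (tri-core T) (tri-core Tz) λ
        { (here refl)                 w∈ → toward-w (toward w∈ (z∉ ∘ here))
        ; (there (here refl))         x∈ → at-x (toward x∈ (z∉ ∘ there ∘ here))
        ; (there (there (here refl))) y∈ → at-y (toward y∈ (z∉ ∘ there ∘ there ∘ here)) }
      where
      toward : ∀ {v} → v ∈ (z ∷ a ∷ b ∷ []) → z ≢ v → z ~ v
      toward (here e) z≢v                = ⊥-elim (z≢v (sym e))
      toward (there (here refl)) _         = za
      toward (there (there (here refl))) _ = zb
      toward-w : z ~ w → ⊥
      toward-w z~w = z∉ (there ([ here , there ∘ here ]′ (only (flip~ z~w))))
      at-x : z ~ x → ⊥
      at-x z~x with tri-orient Tz z~x
      ... | t , Tt with t ≟ y
      ...   | yes refl = twin Tt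
      ...   | no t≢y   = one-shared T Tt (flip≢ t≢y) (z∉ ∘ there ∘ there ∘ here) (avoid x)
      at-y : z ~ y → ⊥
      at-y z~y with tri-orient Tz z~y
      ... | t , Tt with t ≟ x
      ...   | yes refl = twin (Tri-swap {G = G} Tt)
      ...   | no t≢x   = one-shared (Tri-swap {G = G} T) Tt (flip≢ t≢x) (z∉ ∘ there ∘ here) (avoid y)

    -- With the neighbours of y in a core missing x, the excess at x and y already amounts to 8.
    two-shared : ∀ {w w′ x y} → Tri G w x y → Tri G w′ x y → w ≢ w′ → (∀ h → Avoidable h) → ⊥
    two-shared {w} {w′} {x} {y} T@((wx , wy , x≢y , only) , xy) T′@((w′x , w′y , _ , _) , _) w≢w′ avoid =
      avoid x λ { (_ , C , ¬Cx) → avoid y λ { (_ , D , ¬Dy) →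
        tri-hit T C ¬Cx λ Cy → tri-hit (Tri-swap {G = G} T) D ¬Dy λ Dx → main C ¬Cx Cy D ¬Dy Dx } }
      where
      main : ∀ {C D} → Core G C → ¬ C x → C y → Core G D → ¬ D y → D x → ⊥
      main {C} {D} CC ¬Cx Cy CD ¬Dy Dx
        with c , c′ , c≢c′ , (Cc , y~c) , (Cc′ , y~c′) ← proj₂ CC Cy
           | d , d′ , d≢d′ , (Dd , x~d) , (Dd′ , x~d′) ← proj₂ CD Dx
        -- A seventh vertex provides the ninth unit of excess: either its degree is at least 3, or
        -- it is a third vertex of degree 2 over the edge `xy` and raises `x` and `y` to degree 6.
        with z , z∉ ← pickFin (w ∷ w′ ∷ x ∷ y ∷ c ∷ c′ ∷ []) 7≤n = finish
        where
        ¬Cw  = deg2-closed CC (tri-deg T) wx ¬Cx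
        ¬Cw′ = deg2-closed CC (tri-deg T′) w′x ¬Cx
        ¬Dw  = deg2-closed CD (tri-deg T) wy ¬Dy
        ¬Dw′ = deg2-closed CD (tri-deg T′) w′y ¬Dy
        C≢ : ∀ {a b} → ¬ C a → C b → a ≢ b
        C≢ = split {P = C}
        D≢ : ∀ {a b} → ¬ D a → D b → a ≢ b
        D≢ = split {P = D}
        z≢ : ∀ {a} → a ∈ (w ∷ w′ ∷ x ∷ y ∷ c ∷ c′ ∷ []) → a ≢ z
        z≢ a∈ refl = z∉ a∈
        z≢w = z≢ (here refl)
        z≢w′ = z≢ (there (here refl))
        z≢x = z≢ (there (there (here refl)))
        z≢y = z≢ (there (there (there (here refl))))
        deg-y : Unique (w ∷ w′ ∷ x ∷ c ∷ c′ ∷ [])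
        deg-y = (w≢w′ ∷ ≢~ wx ∷ C≢ ¬Cw Cc ∷ C≢ ¬Cw Cc′ ∷ []) ∷ (≢~ w′x ∷ C≢ ¬Cw′ Cc ∷ C≢ ¬Cw′ Cc′ ∷ [])
              ∷ (C≢ ¬Cx Cc ∷ C≢ ¬Cx Cc′ ∷ []) ∷ (c≢c′ ∷ []) ∷ [] ∷ []
        deg-x : Unique (w ∷ w′ ∷ y ∷ d ∷ d′ ∷ [])
        deg-x = (w≢w′ ∷ ≢~ wy ∷ D≢ ¬Dw Dd ∷ D≢ ¬Dw Dd′ ∷ []) ∷ (≢~ w′y ∷ D≢ ¬Dw′ Dd ∷ D≢ ¬Dw′ Dd′ ∷ [])
              ∷ (D≢ ¬Dy Dd ∷ D≢ ¬Dy Dd′ ∷ []) ∷ (d≢d′ ∷ []) ∷ [] ∷ []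
        nbrs-y : All (y ~_) (w ∷ w′ ∷ x ∷ c ∷ c′ ∷ [])
        nbrs-y = flip~ wy ∷ flip~ w′y ∷ flip~ xy ∷ y~c ∷ y~c′ ∷ []
        nbrs-x : All (x ~_) (w ∷ w′ ∷ y ∷ d ∷ d′ ∷ [])
        nbrs-x = flip~ wx ∷ flip~ w′x ∷ xy ∷ x~d ∷ x~d′ ∷ []
        deg-c  = core-nbr T (C≢ ¬Cw Cc) avoid CC ¬Cx Cc y~c
        deg-c′ = core-nbr T (C≢ ¬Cw Cc′) avoid CC ¬Cx Cc′ y~c′
        twin : Tri G z x y → ⊥
        twin Tz@((zx , zy , _ , _) , _) = heavy ((x≢y ∷ C≢ ¬Cx Cc ∷ []) ∷ (≢~ y~c ∷ []) ∷ [] ∷ [])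
          (+-mono-≤ (wt 4 (length≤count ((flip≢ z≢w ∷ flip≢ z≢w′ ∷ flip≢ z≢y ∷ D≢ ¬Dz Dd ∷ D≢ ¬Dz Dd′ ∷ []) ∷ deg-x) (flip~ zx ∷ nbrs-x)))
          (+-mono-≤ (wt 4 (length≤count ((flip≢ z≢w ∷ flip≢ z≢w′ ∷ flip≢ z≢x ∷ C≢ ¬Cz Cc ∷ C≢ ¬Cz Cc′ ∷ []) ∷ deg-y) (flip~ zy ∷ nbrs-y)))
          (+-mono-≤ (wt 1 deg-c) z≤n)))
          where
          ¬Cz = deg2-closed CC (tri-deg Tz) zx ¬Cx
          ¬Dz = deg2-closed CD (tri-deg Tz) zy ¬Dy
        finish : ⊥
        finish with deg G z Nat.≟ 2
        ... | no d≢2 = heavy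
          ((x≢y ∷ C≢ ¬Cx Cc ∷ C≢ ¬Cx Cc′ ∷ z≢x ∷ []) ∷ (≢~ y~c ∷ ≢~ y~c′ ∷ z≢y ∷ [])
           ∷ (c≢c′ ∷ z≢ (there (there (there (there (here refl))))) ∷ []) ∷ (z≢ (there (there (there (there (there (here refl)))))) ∷ []) ∷ [] ∷ [])
          (+-mono-≤ (wt 3 (length≤count deg-x nbrs-x)) (+-mono-≤ (wt 3 (length≤count deg-y nbrs-y))
            (+-mono-≤ (wt 1 deg-c) (+-mono-≤ (wt 1 deg-c′) (+-mono-≤ (wt 1 (deg≢2 d≢2)) z≤n)))))
        ... | yes dz with low dz
        ...   | a , b , Tz = low-pair T Tz
          (λ { (here e) → z≢w (sym e) ; (there (here e)) → z≢x (sym e) ; (there (there (here e))) → z≢y (sym e) }) avoid twin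

    -- With four vertices outside, `degSum-core` gives at least `2n + 2 * 4 + 2`, which is beyond
    -- `2n + 8`.
    few-outside : ∀ L → Core G (_∈ L) → (∀ v → v ∉ L → 3 ≤ deg G v) → 4 + length L ≤ n → ⊥
    few-outside L CL deg≥3 le = 1+n≰n (begin
      suc (2 * n + 9)                         ≡⟨ sym (+-assoc 1 (2 * n) 9) ⟩
      1 + 2 * n + 9                           ≡⟨ lemma n ⟩
      2 * n + 2 * 4 + 2                       ≤⟨ +-monoˡ-≤ 2 (+-monoʳ-≤ (2 * n) (*-monoʳ-≤ 2 4≤cF)) ⟩
      2 * n + 2 * cF + 2                      ≡⟨ cong (λ k → 2 * k + 2 * cF + 2) (sym total) ⟩
      2 * (cD + cF) + 2 * cF + 2              ≡⟨ regroup cD cF ⟩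
      2 * cD + 4 * cF + 2                     ≤⟨ degSum-core sat (mem L) (Core-map {G = G} (mem⁺ L) (mem⁻ L) CL)
                                                   (λ v ¬v → deg≥3 v (outside v ¬v)) (map₂ missing (pickFin L (≤-trans (m≤n+m _ 3) le))) ⟩
      degSum G                                ≤⟨ small ⟩
      2 * n + 8                               ≤⟨ +-monoʳ-≤ (2 * n) (n≤1+n 8) ⟩
      2 * n + 9                               ∎)
      where
      open ≤-Reasoning
      cD = count (mem L)
      cF = count (not ∘ mem L)
      lemma : ∀ n → 1 + 2 * n + 9 ≡ 2 * n + 2 * 4 + 2
      lemma = solve-∀
      regroup : ∀ a b → 2 * (a + b) + 2 * b + 2 ≡ 2 * a + 4 * b + 2
      regroup = solve-∀
      total : cD + cF ≡ n
      total = trans (sym (∑-distrib-+ (ind ∘ mem L) (ind ∘ not ∘ mem L)))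
        (trans (sum-cong-≗ λ i → ind-not (mem L i)) (trans (sum-const n 1) (*-identityʳ n)))
      4≤cF : 4 ≤ cF
      4≤cF = +-cancelʳ-≤ (length L) 4 cF (≤-trans le (subst (_≤ cF + length L) (trans (+-comm cF cD) total)
        (+-monoʳ-≤ cF (count≤length L λ i → mem⁻ L))))
      missing : ∀ {v} → v ∉ L → mem L v ≡ false
      missing v∉ = ≢true⇒≡false (v∉ ∘ mem⁻ L)
      outside : ∀ v → mem L v ≡ false → v ∉ L
      outside v ¬v v∈ with () ← trans (sym (mem⁺ L v∈)) ¬v

    low-outside : ∀ {x y z} → Core G (_∈ (x ∷ y ∷ z ∷ [])) → ∃[ v ] (v ∉ (x ∷ y ∷ z ∷ []) × deg G v ≡ 2)
    low-outside {x} {y} {z} C with any? (λ v → ¬? (v ∈? (x ∷ y ∷ z ∷ [])) ×-dec (deg G v Nat.≟ 2))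
    ... | yes r = r
    ... | no h  = ⊥-elim (few-outside _ C (λ v v∉ → deg≢2 λ d → h (v , v∉ , d)) 7≤n)

    -- The given triangle only serves to find one vertex of degree 2; the triangle at that vertex
    -- then yields a second one outside it.
    with-triangle : (∀ h → Avoidable h) → ∀ {x y z} → x ~ y → y ~ z → x ~ z → ⊥
    with-triangle avoid xy yz xz
      with v , _ , d ← low-outside (triangle⇒core {G = G} xy yz xz)
      with a , b , T ← low d
      with v′ , v′∉ , d′ ← low-outside (tri-core T)
      with a′ , b′ , T′ ← low d′ =
      low-pair T T′ v′∉ avoid λ T″ → two-shared T T″ (λ e → v′∉ (here (sym e))) avoid

    -- Triangle-free graphs

    TriangleFree : Set
    TriangleFree = ∀ {x y z} → x ~ y → y ~ z → x ~ z → ⊥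

    -- Seven vertices split into a path a m b and a 4-cycle s p r q: the edge ms forces a copy of K₃,₄.
    no-K₃₄ : TriangleFree → (∀ v → 3 ≤ deg G v) → n ≡ 7 → ∀ {a m b s p q r} → a ~ m → b ~ m → adj G a b ≡ false →
             s ~ p → s ~ q → r ~ p → r ~ q → p ≢ q → s ≢ r → m ≢ p → m ≢ q → m ~ s → a ≢ b → a ≢ s → b ≢ s → a ≢ r → b ≢ r →
             (∀ z → z ∈ (a ∷ m ∷ b ∷ []) ⊎ z ∈ (s ∷ p ∷ q ∷ r ∷ [])) → ⊥
    no-K₃₄ tf deg≥3 n≡7 {a} {m} {b} {s} {p} {q} {r} a~m b~m a≁b s~p s~q r~p r~q p≢q s≢r m≢p m≢q m~s a≢b a≢s b≢s a≢r b≢r all =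
      -- Seven degrees of at least 3, with `m`, `p`, `q` of degree at least 4, sum to 24, while
      -- `2 * 7 + 8 = 22`.
      1+n≰n {22} (≤-trans (n≤1+n 23) (≤-trans (+-monoʳ-≤ 21 three)
        (subst (λ k → k * 3 + sumᴸ (λ v → deg G v ∸ 3) (m ∷ p ∷ q ∷ []) ≤ 2 * k + 8) n≡7 (≤-trans (excess G deg≥3 mpq) small))))
      where
      a≁b′ : ¬ (a ~ b)
      a≁b′ x with () ← trans (sym x) a≁b
      -- The neighbours of `e` lie among `m`, `p`, `q`, `r`, since `s` would close a triangle with
      -- `m`. As `r` would close one with `p` or `q`, three neighbours leave only `m`, `p`, `q`.
      into : ∀ {e} → e ~ m → ¬ (e ~ a) → ¬ (e ~ b) → e ~ p × e ~ q
      into {e} e~m e≁a e≁b = via (another p) (another q) (another r)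
        where
        another : ∀ x → ∃[ j ] (e ~ j × j ∉ (m ∷ x ∷ []))
        another x = pick (adj G e) (m ∷ x ∷ []) (deg≥3 e)
        on-cycle : ∀ {j} → e ~ j → j ≢ m → j ≡ p ⊎ j ≡ q ⊎ j ≡ r
        on-cycle {j} e~j j≢m with all j
        ... | inj₁ (here refl)                         = ⊥-elim (e≁a e~j)
        ... | inj₁ (there (here e))                    = ⊥-elim (j≢m e)
        ... | inj₁ (there (there (here refl)))         = ⊥-elim (e≁b e~j)
        ... | inj₂ (here refl)                         = ⊥-elim (tf e~m m~s e~j)
        ... | inj₂ (there (here e))                    = inj₁ e
        ... | inj₂ (there (there (here e)))            = inj₂ (inj₁ e)
        ... | inj₂ (there (there (there (here e))))    = inj₂ (inj₂ e)
        e≁r : ∀ {j} → e ~ j → j ≢ m → j ≢ r → e ~ r → ⊥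
        e≁r e~j j≢m j≢r e~r with on-cycle e~j j≢m
        ... | inj₁ refl        = tf e~r r~p e~j
        ... | inj₂ (inj₁ refl) = tf e~r r~q e~j
        ... | inj₂ (inj₂ refl) = j≢r refl
        via : ∃[ j ] (e ~ j × j ∉ (m ∷ p ∷ [])) → ∃[ j ] (e ~ j × j ∉ (m ∷ q ∷ [])) → ∃[ j ] (e ~ j × j ∉ (m ∷ r ∷ [])) → e ~ p × e ~ q
        via (j , e~j , j∉) (k , e~k , k∉) (l , e~l , l∉) = to-p (on-cycle e~k (k∉ ∘ here)) , to-q (on-cycle e~j (j∉ ∘ here))
          where
          ¬r : ¬ (e ~ r)
          ¬r = e≁r e~l (l∉ ∘ here) (l∉ ∘ there ∘ here)
          to-p : k ≡ p ⊎ k ≡ q ⊎ k ≡ r → e ~ p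
          to-p (inj₁ refl)        = e~k
          to-p (inj₂ (inj₁ refl)) = ⊥-elim (k∉ (there (here refl)))
          to-p (inj₂ (inj₂ refl)) = ⊥-elim (¬r e~k)
          to-q : j ≡ p ⊎ j ≡ q ⊎ j ≡ r → e ~ q
          to-q (inj₁ refl)        = ⊥-elim (j∉ (there (here refl)))
          to-q (inj₂ (inj₁ refl)) = e~j
          to-q (inj₂ (inj₂ refl)) = ⊥-elim (¬r e~j)
      a~pq = into a~m (λ x → ≢~ x refl) a≁b′
      b~pq = into b~m (λ x → a≁b′ (flip~ x)) (λ x → ≢~ x refl)
      r~m : r ~ m
      r~m with j , r~j , j∉ ← pick (adj G r) (p ∷ q ∷ []) (deg≥3 r) | all j
      ... | inj₁ (here refl)                      = ⊥-elim (tf r~j (proj₁ a~pq) r~p)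
      ... | inj₁ (there (here refl))              = r~j
      ... | inj₁ (there (there (here refl)))      = ⊥-elim (tf r~j (proj₁ b~pq) r~p)
      ... | inj₂ (here refl)                      = ⊥-elim (tf r~j s~p r~p)
      ... | inj₂ (there (here e))                 = ⊥-elim (j∉ (here e))
      ... | inj₂ (there (there (here e)))         = ⊥-elim (j∉ (there (here e)))
      ... | inj₂ (there (there (there (here e)))) = ⊥-elim (≢~ r~j (sym e))
      mpq : Unique (m ∷ p ∷ q ∷ [])
      mpq = (m≢p ∷ m≢q ∷ []) ∷ (p≢q ∷ []) ∷ [] ∷ []
      four : ∀ {v} → v ~ s → v ~ r → v ~ a → v ~ b → 1 ≤ deg G v ∸ 3
      four vs vr va vb = ∸-monoˡ-≤ 3 (length≤count
        ((s≢r ∷ flip≢ a≢s ∷ flip≢ b≢s ∷ []) ∷ (flip≢ a≢r ∷ flip≢ b≢r ∷ []) ∷ (a≢b ∷ []) ∷ [] ∷ []) (vs ∷ vr ∷ va ∷ vb ∷ []))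
      three : 3 ≤ sumᴸ (λ v → deg G v ∸ 3) (m ∷ p ∷ q ∷ [])
      three = +-mono-≤ (four m~s (flip~ r~m) (flip~ a~m) (flip~ b~m))
        (+-mono-≤ (four (flip~ s~p) (flip~ r~p) (flip~ (proj₁ a~pq)) (flip~ (proj₁ b~pq)))
        (+-mono-≤ (four (flip~ s~q) (flip~ r~q) (flip~ (proj₂ a~pq)) (flip~ (proj₂ b~pq))) z≤n))

    -- No vertex has degree 2, so `3n ≤ 2n + 8`. Two neighbours `a`, `b` of a vertex are not
    -- adjacent; the side of this non-edge takes at least three vertices and its core, having no
    -- triangle, at least four, which nearly exhausts the graph.
    triangle-free : TriangleFree → ⊥
    triangle-free tf = start (pick (adj G v₀) [] (≤-trans (s≤s z≤n) (deg≥3 v₀)))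
      where
      deg≥3 : ∀ v → 3 ≤ deg G v
      deg≥3 v = deg≢2 λ d → case low d of λ { (x , y , (vx , vy , _ , _) , xy) → tf vx xy vy }
      v₀ : Fin n
      v₀ = proj₁ (pickFin [] (≤-trans (s≤s z≤n) 7≤n))
      n≤8 : n ≤ 8
      n≤8 = +-cancelʳ-≤ (2 * n) n 8 (≤-trans (≤-reflexive (lemma n)) (≤-trans (excess G deg≥3 []) (≤-trans small (≤-reflexive (+-comm (2 * n) 8)))))
        where
        lemma : ∀ n → n + 2 * n ≡ n * 3 + 0
        lemma = solve-∀

      module _ {a b} (a≢b : a ≢ b) (v₀~a : v₀ ~ a) (v₀~b : v₀ ~ b) where

        a≁b : ¬ (a ~ b)
        a≁b a~b = tf v₀~a a~b v₀~b

        open Linked (link a≢b (≢≁ a≁b))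

        S≢O : ∀ {i j} → side i ≡ true → other j ≡ true → i ≢ j
        S≢O Si Oj refl = disj Si Oj

        -- Exactly four vertices remain outside the cycle, as many as `few-outside` asks for.
        four-cycle : ∀ {x y z t} → n ≡ 8 → x ~ y → y ~ z → z ~ t → t ~ x → x ≢ z → y ≢ t → ⊥
        four-cycle n≡8 xy yz zt tx x≢z y≢t = few-outside _ (four-cycle⇒core {G = G} xy yz zt tx x≢z y≢t) (λ v _ → deg≥3 v) (≤-reflexive (sym n≡8))

        module _ {m s p q r t} (Sm : side m ≡ true) (a~m : a ~ m) (Os : other s ≡ true)
                 (p≢q : p ≢ q) (Op : other p ≡ true) (s~p : s ~ p) (Oq : other q ≡ true) (s~q : s ~ q)
                 (r≢s : r ≢ s) (Or : other r ≡ true) (p~r : p ~ r)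
                 (t≢s : t ≢ s) (Ot : other t ≡ true) (q~t : q ~ t) where

          m≢b : m ≢ b
          m≢b refl = a≁b a~m

          q≢r : q ≢ r
          q≢r refl = tf s~p p~r s~q

          t≢p : t ≢ p
          t≢p refl = tf s~q q~t s~p

          cyc : List (Fin n)
          cyc = s ∷ p ∷ q ∷ r ∷ []

          seven : Unique (a ∷ m ∷ b ∷ cyc)
          seven = (≢~ a~m ∷ a≢b ∷ S≢O u∈ Os ∷ S≢O u∈ Op ∷ S≢O u∈ Oq ∷ S≢O u∈ Or ∷ [])
            ∷ (m≢b ∷ S≢O Sm Os ∷ S≢O Sm Op ∷ S≢O Sm Oq ∷ S≢O Sm Or ∷ [])
            ∷ (S≢O v∈ Os ∷ S≢O v∈ Op ∷ S≢O v∈ Oq ∷ S≢O v∈ Or ∷ [])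
            ∷ (≢~ s~p ∷ ≢~ s~q ∷ flip≢ r≢s ∷ []) ∷ (p≢q ∷ ≢~ p~r ∷ []) ∷ (q≢r ∷ []) ∷ [] ∷ []

          order-7 : n ≡ 7 → ⊥
          order-7 n≡7 = go (proj₂ (pick (adj G m) (a ∷ b ∷ []) (deg≥3 m)))
            where
            all : ∀ z → z ∈ (a ∷ m ∷ b ∷ cyc)
            all = cover seven (≤-reflexive n≡7)
            cov : ∀ {s p q r} → (∀ {z} → z ∈ cyc → z ∈ (s ∷ p ∷ q ∷ r ∷ [])) → ∀ z → z ∈ (a ∷ m ∷ b ∷ []) ⊎ z ∈ (s ∷ p ∷ q ∷ r ∷ [])
            cov f z with all z
            ... | here e                 = inj₁ (here e)
            ... | there (here e)         = inj₁ (there (here e))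
            ... | there (there (here e)) = inj₁ (there (there (here e)))
            ... | there (there (there c)) = inj₂ (f c)
            -- The core has no room beyond `s`, `p`, `q`, `r`, which forces `t` to be `r`.
            q~r : q ~ r
            q~r with all t
            ... | here refl                                 = ⊥-elim (disj u∈ Ot)
            ... | there (here refl)                         = ⊥-elim (disj Sm Ot)
            ... | there (there (here refl))                 = ⊥-elim (disj v∈ Ot)
            ... | there (there (there (here e)))            = ⊥-elim (t≢s e)
            ... | there (there (there (there (here e))))    = ⊥-elim (t≢p e)
            ... | there (there (there (there (there (here e))))) = ⊥-elim (≢~ q~t (sym e))
            ... | there (there (there (there (there (there (here refl)))))) = q~t
            b~m : b ~ m
            b~m with k , Sk , b~k ← v-nbr | all k
            ... | here refl                 = ⊥-elim (a≁b (flip~ b~k))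
            ... | there (here refl)         = b~k
            ... | there (there (here refl)) = ⊥-elim (≢~ b~k refl)
            ... | there (there (there (here refl)))                          = ⊥-elim (disj Sk Os)
            ... | there (there (there (there (here refl))))                  = ⊥-elim (disj Sk Op)
            ... | there (there (there (there (there (here refl)))))          = ⊥-elim (disj Sk Oq)
            ... | there (there (there (there (there (there (here refl))))))  = ⊥-elim (disj Sk Or)
            -- The 4-cycle s p r q is rotated so that the neighbour of m comes first.
            at : ∀ {s p q r} → other s ≡ true → other p ≡ true → other q ≡ true → other r ≡ true →
                 s ~ p → s ~ q → r ~ p → r ~ q → p ≢ q → s ≢ r → (∀ {z} → z ∈ cyc → z ∈ (s ∷ p ∷ q ∷ r ∷ [])) → m ~ s → ⊥
            at Os Op Oq Or s~p s~q r~p r~q p≢q s≢r f m~s = no-K₃₄ tf deg≥3 n≡7 a~m b~m (≢≁ a≁b) s~p s~q r~p r~q p≢q s≢r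
              (S≢O Sm Op) (S≢O Sm Oq) m~s a≢b (S≢O u∈ Os) (S≢O v∈ Os) (S≢O u∈ Or) (S≢O v∈ Or) (cov f)
            go : ∀ {d} → m ~ d × d ∉ (a ∷ b ∷ []) → ⊥
            go {d} (m~d , d∉) with all d
            ... | here e                 = d∉ (here e)
            ... | there (here e)         = ≢~ m~d (sym e)
            ... | there (there (here e)) = d∉ (there (here e))
            ... | there (there (there (here refl))) = at Os Op Oq Or s~p s~q (flip~ p~r) (flip~ q~r) p≢q (flip≢ r≢s) id m~d
            ... | there (there (there (there (here refl)))) = at Op Os Or Oq (flip~ s~p) p~r (flip~ s~q) q~r (flip≢ r≢s) p≢q
                  (λ { (here e) → there (here e) ; (there (here e)) → here e
                     ; (there (there (here e))) → there (there (there (here e)))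
                     ; (there (there (there (here e)))) → there (there (here e)) }) m~d
            ... | there (there (there (there (there (here refl))))) = at Oq Os Or Op (flip~ s~q) q~r (flip~ s~p) p~r (flip≢ r≢s) (flip≢ p≢q)
                  (λ { (here e) → there (here e) ; (there (here e)) → there (there (there (here e)))
                     ; (there (there (here e))) → here e
                     ; (there (there (there (here e)))) → there (there (here e)) }) m~d
            ... | there (there (there (there (there (there (here refl)))))) = at Or Op Oq Os (flip~ p~r) (flip~ q~r) s~p s~q p≢q r≢s
                  (λ { (here e) → there (there (there (here e))) ; (there (here e)) → there (here e)
                     ; (there (there (here e))) → there (there (here e))
                     ; (there (there (there (here e)))) → here e }) m~d

          order-8 : n ≡ 8 → ⊥
          order-8 n≡8 with t ≟ r
          ... | yes refl = four-cycle n≡8 s~p p~r (flip~ q~t) (flip~ s~q) (flip≢ r≢s) p≢q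
          -- All eight vertices are now named, so every neighbour of `a` except `m` lies in the
          -- core; two of them will close a 4-cycle with `a`.
          ... | no t≢r = go (pick (adj G a) (m ∷ []) (≤-trans (s≤s (s≤s z≤n)) (deg≥3 a)))
            where
            eight : Unique (a ∷ m ∷ b ∷ t ∷ cyc)
            eight with (x₁ ∷ x₂ ∷ xs) ∷ (y₁ ∷ ys) ∷ zs ∷ rest ← seven =
              (x₁ ∷ x₂ ∷ S≢O u∈ Ot ∷ xs) ∷ (y₁ ∷ S≢O Sm Ot ∷ ys) ∷ (S≢O v∈ Ot ∷ zs)
              ∷ (t≢s ∷ t≢p ∷ flip≢ (≢~ q~t) ∷ t≢r ∷ []) ∷ rest
            a-nbr : ∀ {j} → a ~ j → j ≢ m → other j ≡ true
            a-nbr {j} a~j j≢m with cover eight (≤-reflexive n≡8) j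
            ... | here e                 = ⊥-elim (≢~ a~j (sym e))
            ... | there (here e)         = ⊥-elim (j≢m e)
            ... | there (there (here refl)) = ⊥-elim (a≁b a~j)
            ... | there (there (there (here refl)))                         = Ot
            ... | there (there (there (there (here refl))))                 = Os
            ... | there (there (there (there (there (here refl)))))         = Op
            ... | there (there (there (there (there (there (here refl)))))) = Oq
            ... | there (there (there (there (there (there (there (here refl))))))) = Or
            -- Two neighbours of a in the core have a common neighbour there, since it has at most five vertices.
            common : ∀ {j k} → a ~ j → a ~ k → j ≢ k → other j ≡ true → other k ≡ true → ⊥
            common {j} {k} a~j a~k j≢k Oj Ok with proj₂ core Oj | proj₂ core Ok
            ... | c , c′ , c≢c′ , (Oc , j~c) , (Oc′ , j~c′) | d , d′ , d≢d′ , (Od , k~d) , (Od′ , k~d′) =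
              1+n≰n (subst (9 ≤_) n≡8 (length≤n nine))
              where
              sq : ∀ {x y} → other x ≡ true → j ~ x → k ~ y → x ≢ y
              sq Ox j~x k~x refl = four-cycle n≡8 a~j j~x (flip~ k~x) (flip~ a~k) (S≢O u∈ Ox) j≢k
              far : ∀ {j k y} → a ~ j → a ~ k → k ~ y → j ≢ y
              far a~j a~k k~j refl = tf a~k k~j a~j
              nine : Unique (a ∷ m ∷ b ∷ j ∷ k ∷ c ∷ c′ ∷ d ∷ d′ ∷ [])
              nine = (≢~ a~m ∷ a≢b ∷ S≢O u∈ Oj ∷ S≢O u∈ Ok ∷ S≢O u∈ Oc ∷ S≢O u∈ Oc′ ∷ S≢O u∈ Od ∷ S≢O u∈ Od′ ∷ [])
                ∷ (m≢b ∷ S≢O Sm Oj ∷ S≢O Sm Ok ∷ S≢O Sm Oc ∷ S≢O Sm Oc′ ∷ S≢O Sm Od ∷ S≢O Sm Od′ ∷ [])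
                ∷ (S≢O v∈ Oj ∷ S≢O v∈ Ok ∷ S≢O v∈ Oc ∷ S≢O v∈ Oc′ ∷ S≢O v∈ Od ∷ S≢O v∈ Od′ ∷ [])
                ∷ (j≢k ∷ ≢~ j~c ∷ ≢~ j~c′ ∷ far a~j a~k k~d ∷ far a~j a~k k~d′ ∷ [])
                ∷ (far a~k a~j j~c ∷ far a~k a~j j~c′ ∷ ≢~ k~d ∷ ≢~ k~d′ ∷ [])
                ∷ (c≢c′ ∷ sq Oc j~c k~d ∷ sq Oc j~c k~d′ ∷ [])
                ∷ (sq Oc′ j~c′ k~d ∷ sq Oc′ j~c′ k~d′ ∷ [])
                ∷ (d≢d′ ∷ []) ∷ [] ∷ []
            go : ∃[ j ] (a ~ j × j ∉ (m ∷ [])) → ⊥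
            go (j , a~j , j∉) with k , a~k , k∉ ← pick (adj G a) (m ∷ j ∷ []) (deg≥3 a) =
              common a~j a~k (λ e → k∉ (there (here (sym e)))) (a-nbr a~j (j∉ ∘ here)) (a-nbr a~k (k∉ ∘ here))

          order : ⊥
          order with n Nat.≟ 7
          ... | yes n≡7 = order-7 n≡7
          ... | no n≢7  = order-8 (≤-antisym n≤8 (≤∧≢⇒< 7≤n (λ e → n≢7 (sym e))))

        split-core : ⊥
        split-core
          with m , Sm , a~m ← u-nbr | (s , Os) , two ← core
          with p , q , p≢q , (Op , s~p) , (Oq , s~q) ← two Os
          with r , r≢s , Or , p~r ← Two-avoid s (two Op)
             | t , t≢s , Ot , q~t ← Two-avoid s (two Oq) =
          order Sm a~m Os p≢q Op s~p Oq s~q r≢s Or p~r t≢s Ot q~t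

      start : ∃[ a ] (v₀ ~ a × a ∉ []) → ⊥
      start (a , v₀~a , _) with b , v₀~b , b∉ ← pick (adj G v₀) (a ∷ []) (≤-trans (s≤s (s≤s z≤n)) (deg≥3 v₀)) =
        split-core (λ e → b∉ (here (sym e))) v₀~a v₀~b

  impossible : ⊥
  impossible = triangle-free (with-triangle (no-hub sat 7≤n small))

-- Lower bounds

deg2⇒nbrs : ∀ {n} (G : Graph n) {w x y} → deg G w ≡ 2 → Adj G w x → Adj G w y → x ≢ y → Nbrs G w x y
deg2⇒nbrs G {w} {x} {y} d wx wy x≢y = wx , wy , x≢y , only
  where
  only : ∀ {z} → Adj G w z → z ≡ x ⊎ z ≡ y
  only {z} wz with z ≟ x | z ≟ y
  ... | yes e   | _       = inj₁ e
  ... | no _    | yes e   = inj₂ e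
  ... | no z≢x  | no z≢y  = ⊥-elim (1+n≰n (subst (3 ≤_) d
    (length≤count {S = adj G w} ((z≢x ∷ z≢y ∷ []) ∷ (x≢y ∷ []) ∷ [] ∷ []) (wz ∷ wx ∷ wy ∷ []))))

Sparse : ∀ {n} → Graph n → Set₁
Sparse {n} G = CoreSaturated G × degSum G ≤ 2 * n + 8

shrink : ∀ {m a b} → a + 2 ≤ b → b ≤ 2 * suc m + 8 → a ≤ 2 * m + 8
shrink {m} {a} le small = +-cancelʳ-≤ 2 a (2 * m + 8) (≤-trans le (≤-trans small (≤-reflexive (lemma m))))
  where
  lemma : ∀ m → 2 * suc m + 8 ≡ 2 * m + 8 + 2
  lemma = solve-∀

-- For `m = 6` there is no induction hypothesis to use, the wheel being sparse itself; there
-- `seven-leaf` and `seven-path` take its place.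
sparse-step : ∀ {m} → 6 ≤ m → (7 ≤ m → ∀ {G : Graph m} → Sparse G → ⊥) → ∀ {G : Graph (suc m)} → Sparse G → ⊥
sparse-step {m} 6≤m IH {G} (sat , small) = by-leaf (any? λ v → deg G v ≤? 1)
  where
  open CoreSaturated sat
  seven : ∀ {m} → m ≡ 6 → {G : Graph (suc m)} → degSum G ≤ 2 * suc m + 8 → CoreSaturated G → ∀ {l} →
          (deg G l ≡ 1 × ¬ Two (Adj G l)) ⊎
          (deg G l ≡ 2 × ∃₂ λ x y → Nbrs G l (punchIn l x) (punchIn l y) × adj (del G l) x y ≡ false) → ⊥
  seven refl small sat (inj₁ (d , ¬2))              = seven-leaf sat d ¬2 small
  seven refl small sat (inj₂ (d , _ , _ , N , x≁y)) = seven-path sat d N x≁y small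

  Bad : Fin (suc m) → Set
  Bad w = deg G w ≡ 2 × ∃₂ λ x y → Adj G w x × Adj G w y × x ≢ y × adj G x y ≡ false

  bad? : ∀ w → Dec (Bad w)
  bad? w = (deg G w Nat.≟ 2) ×-dec any? λ x → any? λ y →
    (adj G w x Bool.≟ true) ×-dec (adj G w y Bool.≟ true) ×-dec ¬? (x ≟ y) ×-dec (adj G x y Bool.≟ false)

  leaf : ∀ l → deg G l ≤ 1 → ⊥
  leaf l d≤1 = by (m Nat.≟ 6)
    where
    1≤d : 1 ≤ deg G l
    1≤d = joins⇒deg G (s≤s (≤-trans (s≤s z≤n) 6≤m)) (λ u≢v u≁v → Linked.joined (link u≢v u≁v)) l
    ¬2 : ¬ Two (Adj G l)
    ¬2 t = 1+n≰n (≤-trans (Two-count {S = adj G l} t) d≤1)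
    pruned : degSum (del G l) + 2 ≤ degSum G
    pruned = subst (degSum (del G l) + 2 ≤_) (sym (degSum-del G l)) (+-monoʳ-≤ (degSum (del G l)) (*-monoʳ-≤ 2 1≤d))
    by : Dec (m ≡ 6) → ⊥
    by (yes m≡6) = seven m≡6 {G} small sat {l} (inj₁ (≤-antisym d≤1 1≤d , ¬2))
    by (no m≢6)  = IH (≤∧≢⇒< 6≤m (λ e → m≢6 (sym e))) {del G l} (remove-leaf sat ¬2 , shrink {m} pruned small)

  subdivided : ∀ w → Bad w → ⊥
  subdivided w (d , x , y , wx , wy , x≢y , x≁y) with punchIn-view w x | punchIn-view w y
  ... | inj₁ refl       | _               = Adj-≢ G wx refl
  ... | inj₂ _          | inj₁ refl       = Adj-≢ G wy refl
  ... | inj₂ (i , refl) | inj₂ (j , refl) with m Nat.≟ 6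
  ...   | yes m≡6 = seven m≡6 {G} small sat {w} (inj₂ (d , i , j , N , x≁y))
    where N = deg2⇒nbrs G d wx wy x≢y
  ...   | no m≢6 = IH (≤∧≢⇒< 6≤m (λ e → m≢6 (sym e))) {suppressed} (suppress , shrink {m} (degSum-suppressed d) small)
    where open Suppress {G = G} sat (deg2⇒nbrs G d wx wy x≢y) x≁y

  reduced : (∀ v → ¬ (deg G v ≤ 1)) → (∀ w → ¬ Bad w) → ⊥
  reduced deg≰1 ¬bad = Reduced.impossible {G = G} sat (s≤s 6≤m) small (λ v → ≰⇒> (deg≰1 v)) low
    where
    low : ∀ {v} → deg G v ≡ 2 → ∃₂ λ x y → Tri G v x y
    low {v} d with x , vx , _ ← pick (adj G v) [] (subst (0 <_) (sym d) (s≤s z≤n))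
              with y , vy , y∉ ← pick (adj G v) (x ∷ []) (subst (1 <_) (sym d) ≤-refl) =
      x , y , deg2⇒nbrs G d vx vy x≢y , decidable-stable (adj G x y Bool.≟ true)
        λ ¬a → ¬bad v (d , x , y , vx , vy , x≢y , ≢true⇒≡false ¬a)
      where x≢y = λ x≡y → y∉ (here (sym x≡y))

  by-leaf : Dec (∃[ v ] deg G v ≤ 1) → ⊥
  by-leaf (yes (l , d)) = leaf l d
  by-leaf (no ¬leaf)    = by-path (any? bad?)
    where
    by-path : Dec (∃ Bad) → ⊥
    by-path (yes (w , b)) = subdivided w b
    by-path (no ¬bad)     = reduced (λ v d → ¬leaf (v , d)) (λ w b → ¬bad (w , b))

no-sparse : ∀ n → 7 ≤ n → ∀ {G : Graph n} → Sparse G → ⊥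
no-sparse (suc m) (s≤s 6≤m) {G} = sparse-step 6≤m (λ 7≤m {G′} → no-sparse m 7≤m {G′}) {G}

lower-bound : ∀ {n} → 7 ≤ n → (G : Graph n) → Saturated G → n + 5 ≤ edgeCount G
lower-bound {n} 7≤n G sat = ≮⇒≥ λ e<n+5 → no-sparse n 7≤n {G} (saturated⇒core sat , few (s≤s⁻¹ (subst (edgeCount G <_) (+-suc n 4) e<n+5)))
  where
  lemma : ∀ n → (n + 4) + (n + 4) ≡ 2 * n + 8
  lemma = solve-∀
  few : edgeCount G ≤ n + 4 → degSum G ≤ 2 * n + 8
  few le = subst₂ _≤_ (sym (degSum≡2edges G)) (lemma n) (+-mono-≤ le le)

-- Nine edges or fewer would still force a wheel, but its degree sum exceeds 18: six degrees of at
-- least 3, and a larger one at the hub.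
lower-bound-6 : (G : Graph 6) → Saturated G → 10 ≤ edgeCount G
lower-bound-6 G sat = ≮⇒≥ λ e<10 → let e≤9 = s≤s⁻¹ e<10
                                       small = subst (_≤ 18) (sym (degSum≡2edges G)) (+-mono-≤ e≤9 e≤9)
                                   in no-wheel small (six-vertices {G} (saturated⇒core sat) (≤-trans small (+-monoʳ-≤ 18 z≤n)))
  where
  no-wheel : degSum G ≤ 18 → ∃[ h ] Wheel G h → ⊥
  no-wheel small (h , wheel) = 1+n≰n {18} (≤-trans (+-monoʳ-≤ 18 two) (≤-trans (excess G {3} {h ∷ []} deg≥3 ([] ∷ [])) small))
    where
    deg-h : 5 ≤ deg G h
    deg-h = +-cancelʳ-≤ 1 5 (deg G h) (universal⇒deg G {h} (λ v≢h → proj₁ (wheel v≢h)))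
    deg≥3 : ∀ v → 3 ≤ deg G v
    deg≥3 v with v ≟ h
    ... | yes refl = ≤-trans (+-monoʳ-≤ 3 z≤n) deg-h
    ... | no v≢h   = ≤-reflexive (sym (proj₂ (wheel v≢h)))
    two : 1 ≤ (deg G h ∸ 3) + 0
    two = ≤-trans (s≤s z≤n) (≤-trans (∸-monoˡ-≤ 3 deg-h) (m≤m+n _ 0))

-- Extremal graphs

path-triangle⇒cycles : ∀ {n} {G : Graph n} {u v} (u≢v : u ≢ v) → PathTriangle G u v → TwoDisjointCycles (addEdge G u v u≢v)
path-triangle⇒cycles {G = G} {u} {v} u≢v (m , s , q , r ,
    (_ ∷ _ ∷ u≢s ∷ u≢q ∷ u≢r ∷ []) ∷ (_ ∷ m≢s ∷ m≢q ∷ m≢r ∷ []) ∷ (v≢s ∷ v≢q ∷ v≢r ∷ []) ∷ _ ,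
    (u~m , v~m) , (s~q , s~r , q~r)) =
  cores⇒cycles (_ , _ , triangle⇒core {G = H} (old u~m) (Adj-sym H (old v~m)) (addEdge-new G u≢v)
                      , triangle⇒core {G = H} (old s~q) (old q~r) (old s~r) , λ
    { (here refl)                 → λ { (here e) → u≢s e ; (there (here e)) → u≢q e ; (there (there (here e))) → u≢r e }
    ; (there (here refl))         → λ { (here e) → m≢s e ; (there (here e)) → m≢q e ; (there (there (here e))) → m≢r e }
    ; (there (there (here refl))) → λ { (here e) → v≢s e ; (there (here e)) → v≢q e ; (there (there (here e))) → v≢r e } })
  where
  H = addEdge G u v u≢v
  old : ∀ {x y} → Adj G x y → Adj H x y
  old = addEdge-⊆ G u≢v

cycles⇒cores : ∀ {n} {G : Graph n} → TwoDisjointCycles G → DisjointCores G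
cycles⇒cores (C , D , disj) = _ , _ , cycle⇒core C , cycle⇒core D , λ zC zD → All.lookup disj zC zD

fromUpper : ∀ {n} → Upper n → Graph n
fromUpper U = record { adj = adjᵁ U ; sym = adjᵁ-sym U ; irrefl = adjᵁ-irrefl U }
  where
  adjᵁ-sym : ∀ {n} (U : Upper n) i j → adjᵁ U i j ≡ adjᵁ U j i
  adjᵁ-sym U zero    zero    = refl
  adjᵁ-sym U zero    (suc j) = refl
  adjᵁ-sym U (suc i) zero    = refl
  adjᵁ-sym U (suc i) (suc j) = adjᵁ-sym (proj₂ U) i j
  adjᵁ-irrefl : ∀ {n} (U : Upper n) i → adjᵁ U i i ≡ false
  adjᵁ-irrefl U zero    = refl
  adjᵁ-irrefl U (suc i) = adjᵁ-irrefl (proj₂ U) i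

-- The wheel with hub 0 and rim 1 2 3 4 5.
W₆ : Graph 6
W₆ = fromUpper {6}
  ( true ∷ true ∷ true ∷ true ∷ true ∷ []
  , true ∷ false ∷ false ∷ true ∷ []
  , true ∷ false ∷ false ∷ []
  , true ∷ false ∷ []
  , true ∷ []
  , [] , tt)

W₆-wheel : Wheel W₆ zero
W₆-wheel {zero}                                 v≢0 = contradiction refl v≢0
W₆-wheel {suc zero}                             _   = refl , refl
W₆-wheel {suc (suc zero)}                       _   = refl , refl
W₆-wheel {suc (suc (suc zero))}                 _   = refl , refl
W₆-wheel {suc (suc (suc (suc zero)))}           _   = refl , refl
W₆-wheel {suc (suc (suc (suc (suc zero))))}     _   = refl , refl

-- One of two disjoint cores misses the hub and so takes the whole rim, yet the other one also has a
-- vertex on the rim.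
wheel⇒¬cores : ∀ {G : Graph 6} {h} → Wheel G h → DisjointCores G → ⊥
wheel⇒¬cores {G} {h} wheel (P , Q , CP , CQ , disj) = rim CP CQ disj λ Ph → rim CQ CP (flip disj) (disj Ph)
  where
  rim : ∀ {P Q} → Core G P → Core G Q → (∀ {v} → P v → Q v → ⊥) → ¬ P h → ⊥
  rim CP ((_ , Qq) , two) disj ¬Ph with p , p≢h , Qp , _ ← Two-avoid h (two Qq) =
    wheel-core {G} wheel CP ¬Ph p≢h (λ Pp → disj Pp Qp)

W₆-saturated : Saturated W₆
W₆-saturated = wheel⇒¬cores {W₆} W₆-wheel ∘ cycles⇒cores , λ u v u≢v u≁v → path-triangle⇒cycles u≢v (pairs u v u≢v u≁v)
  where
  PathTriangle? : ∀ u v → Dec (PathTriangle W₆ u v)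
  PathTriangle? u v = any? λ m → any? λ s → any? λ q → any? λ r → unique?-dec _≟_ (u ∷ m ∷ v ∷ s ∷ q ∷ r ∷ []) ×-dec
    ((adj W₆ u m Bool.≟ true) ×-dec (adj W₆ v m Bool.≟ true)) ×-dec
    ((adj W₆ s q Bool.≟ true) ×-dec (adj W₆ s r Bool.≟ true) ×-dec (adj W₆ q r Bool.≟ true))
  pairs : ∀ u v → u ≢ v → adj W₆ u v ≡ false → PathTriangle W₆ u v
  pairs = from-yes (all? λ u → all? λ v → ¬? (u ≟ v) →-dec (adj W₆ u v Bool.≟ false) →-dec PathTriangle? u v)

small : ∀ {n} → Fin n → Bool
small i = toℕ i <ᵇ 5

root : ∀ {n} → Fin n → Bool
root i = toℕ i <ᵇ 1

≟-comm : ∀ {n} (i j : Fin n) → ⌊ i ≟ j ⌋ ≡ ⌊ j ≟ i ⌋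
≟-comm i j with i ≟ j | j ≟ i
... | yes _ | yes _ = refl
... | yes p | no q  = contradiction (sym p) q
... | no p  | yes q = contradiction (sym q) p
... | no _  | no _  = refl

-- K₅ on 0, …, 4 with all further vertices pendant at 0.
pendant-K₅ : ∀ n → Graph n
pendant-K₅ n = record { adj = A ; sym = A-sym ; irrefl = A-irrefl }
  where
  A : Fin n → Fin n → Bool
  A i j = ((small i ∧ small j) ∨ (root i ∨ root j)) ∧ not ⌊ i ≟ j ⌋
  A-sym : ∀ i j → A i j ≡ A j i
  A-sym i j rewrite ∧-comm (small i) (small j) | ∨-comm (root i) (root j) | ≟-comm i j = refl
  A-irrefl : ∀ i → A i i ≡ false
  A-irrefl i rewrite isYes⁺ (i ≟ i) refl = ∧-zeroʳ _

module PendantK₅ (k : ℕ) where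

  K : Graph (5 + k)
  K = pendant-K₅ (5 + k)

  adjacent : ∀ {i j} → i ≢ j → (small i ∧ small j) ∨ (root i ∨ root j) ≡ true → Adj K i j
  adjacent {i} {j} i≢j h rewrite h | ≢true⇒≡false (i≢j ∘ isYes⁻ (i ≟ j)) = refl

  root⇒zero : ∀ {i : Fin (5 + k)} → root i ≡ true → i ≡ zero
  root⇒zero {zero} _ = refl

  root⇒small : ∀ {i : Fin (5 + k)} → root i ≡ true → small i ≡ true
  root⇒small {zero} _ = refl

  pendant : ∀ {v j} → small v ≡ false → Adj K v j → j ≡ zero
  pendant {v} {j} ¬s a with proj₁ (∧-true {(small v ∧ small j) ∨ (root v ∨ root j)} a)
  ... | h rewrite ¬s with root v in rv
  ...   | false = root⇒zero h
  ...   | true with () ← trans (sym (root⇒small {v} rv)) ¬s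

  core-small : ∀ {P v} → Core K P → P v → small v ≡ true
  core-small {P} {v} (_ , two) Pv = decidable-stable (small v Bool.≟ true) λ ¬s → case two Pv of λ
    { (p , q , p≢q , (_ , vp) , (_ , vq)) → p≢q (trans (pendant {v} (≢true⇒≡false ¬s) vp) (sym (pendant {v} (≢true⇒≡false ¬s) vq))) }

  count-small : count {5 + k} small ≡ 5
  count-small = cong (5 +_) (sum-zero {k} λ _ → refl)

  -- Pendant vertices lie in no core, so the two cores would need six of the five vertices of `K₅`.
  no-cores : DisjointCores K → ⊥
  no-cores (P , Q , CP@((x , Px) , twoP) , CQ@((y , Qy) , twoQ) , disj)
    with p , p′ , p≢p′ , (Pp , xp) , (Pp′ , xp′) ← twoP Px
       | q , q′ , q≢q′ , (Qq , yq) , (Qq′ , yq′) ← twoQ Qy =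
    1+n≰n (subst (6 ≤_) count-small (length≤count {S = small}
      ((Adj-≢ K xp ∷ Adj-≢ K xp′ ∷ ≢PQ Px Qy ∷ ≢PQ Px Qq ∷ ≢PQ Px Qq′ ∷ [])
       ∷ (p≢p′ ∷ ≢PQ Pp Qy ∷ ≢PQ Pp Qq ∷ ≢PQ Pp Qq′ ∷ [])
       ∷ (≢PQ Pp′ Qy ∷ ≢PQ Pp′ Qq ∷ ≢PQ Pp′ Qq′ ∷ [])
       ∷ (Adj-≢ K yq ∷ Adj-≢ K yq′ ∷ []) ∷ (q≢q′ ∷ []) ∷ [] ∷ [])
      (core-small CP Px ∷ core-small CP Pp ∷ core-small CP Pp′ ∷ core-small CQ Qy ∷ core-small CQ Qq ∷ core-small CQ Qq′ ∷ [])))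
    where
    ≢PQ : ∀ {a b} → P a → Q b → a ≢ b
    ≢PQ Pa Qb refl = disj Pa Qb

  -- `x` is the end of the non-edge uv inside K₅, if it has one.
  opposite : ∀ {u v} → u ≢ v → adj K u v ≡ false → ∀ x → (∀ {z} → z ≢ x → small z ≡ true → z ≢ u × z ≢ v) → PathTriangle K u v
  opposite {u} {v} u≢v u≁v x away
    -- The path runs through the root, so the triangle has to avoid the root and `x`; this leaves
    -- exactly three vertices of `K₅`.
    with s , Ss , s∉ ← pick small (zero ∷ x ∷ []) (subst (2 <_) (sym count-small) (s≤s (s≤s (s≤s z≤n))))
    with q , Sq , q∉ ← pick small (s ∷ zero ∷ x ∷ []) (subst (3 <_) (sym count-small) (s≤s (s≤s (s≤s (s≤s z≤n)))))
    with r , Sr , r∉ ← pick small (q ∷ s ∷ zero ∷ x ∷ []) (subst (4 <_) (sym count-small) ≤-refl) =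
    zero , s , q , r ,
      ((u≢0 ∷ u≢v ∷ ≢u Ss s≢x ∷ ≢u Sq q≢x ∷ ≢u Sr r≢x ∷ [])
       ∷ ((λ e → v≢0 (sym e)) ∷ (λ e → s∉ (here (sym e))) ∷ (λ e → q∉ (there (here (sym e)))) ∷ (λ e → r∉ (there (there (here (sym e))))) ∷ [])
       ∷ (≢v Ss s≢x ∷ ≢v Sq q≢x ∷ ≢v Sr r≢x ∷ [])
       ∷ (s≢q ∷ s≢r ∷ []) ∷ (q≢r ∷ []) ∷ [] ∷ []) ,
      (to-root u≢0 , to-root v≢0) , (both s≢q Ss Sq , both s≢r Ss Sr , both q≢r Sq Sr)
    where
    s≢x = s∉ ∘ there ∘ here
    q≢x = q∉ ∘ there ∘ there ∘ here
    r≢x = r∉ ∘ there ∘ there ∘ there ∘ here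
    s≢q = λ e → q∉ (here (sym e))
    s≢r = λ e → r∉ (there (here (sym e)))
    q≢r = λ e → r∉ (here (sym e))
    ≢u : ∀ {z} → small z ≡ true → z ≢ x → u ≢ z
    ≢u Sz z≢x e = proj₁ (away z≢x Sz) (sym e)
    ≢v : ∀ {z} → small z ≡ true → z ≢ x → v ≢ z
    ≢v Sz z≢x e = proj₂ (away z≢x Sz) (sym e)
    to-root : ∀ {z} → z ≢ zero → Adj K z zero
    to-root {z} z≢0 = adjacent z≢0 (trans (cong (small z ∧ true ∨_) (∨-zeroʳ (root z))) (∨-zeroʳ (small z ∧ true)))
    both : ∀ {a b} → a ≢ b → small a ≡ true → small b ≡ true → Adj K a b
    both {a} {b} a≢b Sa Sb = adjacent a≢b (cong (_∨ (root a ∨ root b)) (∧-intro Sa Sb))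
    nonadj : ∀ {a b} → Adj K a b → adj K a b ≡ false → ⊥
    nonadj a b with () ← trans (sym a) b
    u≢0 : u ≢ zero
    u≢0 refl = nonadj {zero} {v} (Adj-sym K {v} {zero} (to-root (λ e → u≢v (sym e)))) u≁v
    v≢0 : v ≢ zero
    v≢0 refl = nonadj {u} {zero} (to-root u≢v) u≁v

  K-saturated : Saturated K
  K-saturated = no-cores ∘ cycles⇒cores , λ u v u≢v u≁v → path-triangle⇒cycles u≢v (pair u≢v u≁v)
    where
    pair : ∀ {u v} → u ≢ v → adj K u v ≡ false → PathTriangle K u v
    pair {u} {v} u≢v u≁v = by (small u Bool.≟ true) (small v Bool.≟ true)
      where
      by : Dec (small u ≡ true) → Dec (small v ≡ true) → PathTriangle K u v
      by _        (no ¬v) = opposite u≢v u≁v u λ z≢u Sz → z≢u , λ { refl → ¬v Sz }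
      by (no ¬u)  _       = opposite u≢v u≁v v λ z≢v Sz → (λ { refl → ¬u Sz }) , z≢v
      by (yes Su) (yes Sv) with () ← trans (sym u≁v) (adjacent u≢v (cong (_∨ (root u ∨ root v)) (∧-intro Su Sv)))

  K-edges : edgeCount K ≡ 5 + k + 5
  K-edges = *-cancelˡ-≡ (edgeCount K) (5 + k + 5) 2 (trans (double (edgeCount K)) (trans (sym (degSum≡2edges K)) total))
    where
    double : ∀ e → 2 * e ≡ e + e
    double = solve-∀
    none : sum {k} (λ _ → 0) ≡ 0
    none = sum-zero {k} λ _ → refl
    one : sum {k} (λ _ → 1) ≡ k
    one = trans (sum-const k 1) (*-identityʳ k)
    -- The root has degree `4 + k`, the other four vertices of `K₅` have degree 4, and the `k`
    -- pendant vertices have degree 1.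
    lemma : ∀ k → 4 + k + (4 + (4 + (4 + (4 + k)))) ≡ 2 * (5 + k + 5)
    lemma = solve-∀
    total : degSum K ≡ 2 * (5 + k + 5)
    total = trans (cong₂ _+_ (cong (4 +_) one) (cong₂ _+_ four (cong₂ _+_ four (cong₂ _+_ four (cong₂ _+_ four pendants))))) (lemma k)
      where
      four : 4 + sum {k} (λ _ → 0) ≡ 4
      four = cong (4 +_) none
      pendants : sum {k} (λ j → deg K (suc (suc (suc (suc (suc j)))))) ≡ k
      pendants = trans (sum-cong-≗ {k} λ _ → cong suc none) one

theorem1p3 : SatNumberIs 6 10 × (∀ (n : ℕ) → 7 ≤ n → SatNumberIs n (n + 5))
theorem1p3 = ((W₆ , W₆-saturated , refl) , lower-bound-6) , λ n 7≤n → witness n 7≤n , lower-bound 7≤n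
  where
  witness : ∀ n → 7 ≤ n → Σ (Graph n) λ G → Saturated G × edgeCount G ≡ n + 5
  witness n 7≤n = subst (λ n → Σ (Graph n) λ G → Saturated G × edgeCount G ≡ n + 5) (m+[n∸m]≡n (≤-trans (+-monoʳ-≤ 5 z≤n) 7≤n))
    (K , K-saturated , K-edges)
    where open PendantK₅ (n ∸ 5)
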